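{- Let $k\geq 2$ be an integer and let $M$ be a minimally $k$-degenerate matroid. Then $|E(M)|\leq (k-1)r(M)+1$. Moreover, equality is attained if and only if $M$ can be obtained via iterated series connections of copies of $U_{1,k}$.
   Context: All matroids are finite, loopless, with non-empty ground set, and may have parallel elements; all restrictions considered are non-empty. The cogirth $g^*(M)$ is the size of a smallest cocircuit of $M$. For an integer $k\geq 2$, a loopless matroid $M$ is minimally $k$-degenerate if $g^*(M)=k$ and every proper (non-empty) restriction of $M$ has cogirth at most $k-1$. $U_{r,n}$ denotes the uniform matroid of rank $r$ on $n$ elements. If $E(M_1)\cap E(M_2)=\{p\}$ and $p$ is neither a loop nor a coloop of $M_1$ or $M_2$, the series connection $S(M_1,M_2)$ with basepoint $p$ is the matroid on $E(M_1)\cup E(M_2)$ whose cocircuits are the cocircuits of $M_1$, the cocircuits of $M_2$, and the sets $(C_1^*\cup C_2^*)-\{p\}$ where $C_i^*$ is a cocircuit of $M_i$ containing $p$ for $i=1,2$. "Obtained via iterated series connections of copies of $U_{1,k}$" means belonging to the smallest isomorphism-closed class of matroids that contains $U_{1,k}$ and is closed under series connection ($U_{1,k}$ itself is included). -}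

module Defs where

open import Data.Bool.Base using (true; false)
open import Data.Fin.Base using (Fin; zero; suc)
open import Data.Fin.Subset
open import Data.Fin.Subset.Properties
open import Data.List.Base using (List; []; _∷_; _++_; map; filter)
open import Data.List.Extrema.Nat using (max)
open import Data.Nat.Base using (ℕ; zero; suc; _∸_; _≤_; _<_; z≤n; s≤s)
open import Data.Nat.Properties
  using (≤-trans; ≤-refl; ≤-reflexive; m≤n⇒m≤1+n; _≤?_)
open import Data.Product using (∃; ∃-syntax; _×_; _,_; proj₁; proj₂)
open import Data.Sum.Base using (_⊎_; [_,_]′)
open import Data.Vec.Base using ([]; _∷_; here; there)
open import Function.Base using (_∘_)
open import Function.Bundles using (_↔_; _⇔_; Inverse)
open import Relation.Binary.PropositionalEquality using (_≡_; refl; cong)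
open import Relation.Nullary using (¬_)
open import Relation.Nullary.Decidable using (_×-dec_)
open import Relation.Unary using (Decidable)

private
  variable
    m n : ℕ

-- The ground set is an arbitrary subset E of the universe Fin n, so that
-- matroids whose ground sets overlap in a prescribed way (as in a series
-- connection) and restrictions can be written without relabelling.
-- Independence is decidable since matroids are finite objects.
record Matroid (n : ℕ) : Set₁ where
  field
    E       : Subset n
    Indep   : Subset n → Set
    indep?  : Decidable Indep
    indep⊆E : ∀ {I} → Indep I → I ⊆ E
    indep-⊥ : Indep ⊥
    indep-⊆ : ∀ {I J} → I ⊆ J → Indep J → Indep I
    augment : ∀ {I J} → Indep I → Indep J → ∣ I ∣ < ∣ J ∣ →
              ∃[ e ] e ∈ J × e ∉ I × Indep (I ∪ ⁅ e ⁆)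

open Matroid public

allSubsets : ∀ n → List (Subset n)
allSubsets zero    = [] ∷ []
allSubsets (suc n) =
  map (inside ∷_) (allSubsets n) ++ map (outside ∷_) (allSubsets n)

rank : Matroid n → ℕ
rank {n} M = max 0 (map ∣_∣ (filter (indep? M) (allSubsets n)))

IsBasis : Matroid n → Subset n → Set
IsBasis M B = Indep M B × (∀ {I} → Indep M I → B ⊆ I → I ⊆ B)

IsLoop : Matroid n → Fin n → Set
IsLoop M e = e ∈ E M × ¬ Indep M ⁅ e ⁆

IsColoop : Matroid n → Fin n → Set
IsColoop M e = e ∈ E M × (∀ {B} → IsBasis M B → e ∈ B)

Loopless : Matroid n → Set
Loopless M = ∀ e → ¬ IsLoop M e

-- Independence in the dual matroid, whose bases are the complements E ─ B.
Coindep : Matroid n → Subset n → Set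
Coindep M X = ∃[ B ] IsBasis M B × X ⊆ E M ─ B

-- A circuit (minimal dependent set) of the dual matroid.
IsCocircuit : Matroid n → Subset n → Set
IsCocircuit M C =
  C ⊆ E M × ¬ Coindep M C × (∀ {D} → D ⊂ C → Coindep M D)

-- A relation rather than a function, as a matroid of rank 0 has no cocircuit.
IsCogirth : Matroid n → ℕ → Set
IsCogirth M g =
  (∃[ C ] IsCocircuit M C × ∣ C ∣ ≡ g) ×
  (∀ {C} → IsCocircuit M C → g ≤ ∣ C ∣)

restrict : (M : Matroid n) {X : Subset n} → X ⊆ E M → Matroid n
restrict M {X} X⊆E = record
  { E       = X
  ; Indep   = λ I → I ⊆ X × Indep M I
  ; indep?  = λ I → (I ⊆? X) ×-dec indep? M I
  ; indep⊆E = proj₁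
  ; indep-⊥ = ⊥⊆ , indep-⊥ M
  ; indep-⊆ = λ { I⊆J (J⊆X , iJ) → ⊆-trans I⊆J J⊆X , indep-⊆ M I⊆J iJ }
  ; augment = λ { {I} (I⊆X , iI) (J⊆X , iJ) I<J →
      let (e , e∈J , e∉I , i) = augment M iI iJ I<J in
      e , e∈J , e∉I ,
      ( (λ x∈ → [ I⊆X , (λ x∈e → J⊆X (⊆-singleton e∈J x∈e)) ]′
                  (x∈p∪q⁻ I ⁅ e ⁆ x∈))
      , i ) }
  }
  where
  ⊆-singleton : ∀ {n} {e : Fin n} {J} → e ∈ J → ⁅ e ⁆ ⊆ J
  ⊆-singleton {e = e} e∈J x∈ with refl ← x∈⁅y⁆⇒x≡y e x∈ = e∈J

record MinimallyDegenerate (k : ℕ) (M : Matroid n) : Set where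
  field
    nonempty     : Nonempty (E M)
    loopless     : Loopless M
    cogirth      : IsCogirth M k
    restrictions : ∀ {X} (X⊂E : X ⊂ E M) → Nonempty X →
                   ∃[ g ] IsCogirth (restrict M (proj₁ X⊂E)) g × g ≤ k ∸ 1

larger⇒∃∉ : (I J : Subset n) → ∣ I ∣ < ∣ J ∣ → ∃[ e ] e ∈ J × e ∉ I
larger⇒∃∉ (false ∷ I) (true ∷ J) _ = zero , here , λ ()
larger⇒∃∉ (false ∷ I) (false ∷ J) lt with larger⇒∃∉ I J lt
... | e , e∈J , e∉I = suc e , there e∈J , e∉I ∘ drop-there
larger⇒∃∉ (true ∷ I) (true ∷ J) (s≤s lt) with larger⇒∃∉ I J lt
... | e , e∈J , e∉I = suc e , there e∈J , e∉I ∘ drop-there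
larger⇒∃∉ (true ∷ I) (false ∷ J) lt
  with larger⇒∃∉ I J (≤-trans (m≤n⇒m≤1+n ≤-refl) lt)
... | e , e∈J , e∉I = suc e , there e∈J , e∉I ∘ drop-there

∣p∪⁅x⁆∣≤1+∣p∣ : (p : Subset n) (x : Fin n) → ∣ p ∪ ⁅ x ⁆ ∣ ≤ suc ∣ p ∣
∣p∪⁅x⁆∣≤1+∣p∣ (true  ∷ p) zero    =
  s≤s (m≤n⇒m≤1+n (≤-reflexive (cong ∣_∣ (∪-identityʳ p))))
∣p∪⁅x⁆∣≤1+∣p∣ (false ∷ p) zero    =
  s≤s (≤-reflexive (cong ∣_∣ (∪-identityʳ p)))
∣p∪⁅x⁆∣≤1+∣p∣ (true  ∷ p) (suc x) = s≤s (∣p∪⁅x⁆∣≤1+∣p∣ p x)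
∣p∪⁅x⁆∣≤1+∣p∣ (false ∷ p) (suc x) = ∣p∪⁅x⁆∣≤1+∣p∣ p x

U : (r n : ℕ) → Matroid n
U r n = record
  { E       = ⊤
  ; Indep   = λ I → ∣ I ∣ ≤ r
  ; indep?  = λ I → ∣ I ∣ ≤? r
  ; indep⊆E = λ _ → ⊆⊤
  ; indep-⊥ = ≤-trans (≤-reflexive (∣⊥∣≡0 n)) z≤n
  ; indep-⊆ = λ I⊆J → ≤-trans (p⊆q⇒∣p∣≤∣q∣ I⊆J)
  ; augment = λ {I} {J} _ J≤r I<J →
      let (e , e∈J , e∉I) = larger⇒∃∉ I J I<J in
      e , e∈J , e∉I , ≤-trans (∣p∪⁅x⁆∣≤1+∣p∣ I e) (≤-trans I<J J≤r)
  }

-- The universes may differ; only the ground sets are put in bijection.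
record _≅_ (M : Matroid m) (N : Matroid n) : Set where
  field
    bij : (∃[ e ] e ∈ E M) ↔ (∃[ e ] e ∈ E N)

  -- J is the image of I under bij.
  IsImage : Subset m → Subset n → Set
  IsImage I J = ∀ x → proj₁ x ∈ I ⇔ proj₁ (Inverse.to bij x) ∈ J

  field
    indep⇔ : ∀ {I J} → I ⊆ E M → J ⊆ E N → IsImage I J →
             Indep M I ⇔ Indep N J

-- S is the series connection of M₁ and M₂ with basepoint p. A matroid is
-- determined by its ground set and its cocircuits. The basepoint p stays in
-- the ground set of S.
record IsSeriesConnection (M₁ M₂ : Matroid n) (p : Fin n) (S : Matroid n)
       : Set where
  field
    meet        : E M₁ ∩ E M₂ ≡ ⁅ p ⁆
    not-loop₁   : ¬ IsLoop M₁ p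
    not-coloop₁ : ¬ IsColoop M₁ p
    not-loop₂   : ¬ IsLoop M₂ p
    not-coloop₂ : ¬ IsColoop M₂ p
    ground      : E S ≡ E M₁ ∪ E M₂
    cocircuits  : ∀ C → IsCocircuit S C ⇔
      ( IsCocircuit M₁ C
      ⊎ IsCocircuit M₂ C
      ⊎ (∃[ C₁ ] ∃[ C₂ ] IsCocircuit M₁ C₁ × p ∈ C₁
                       × IsCocircuit M₂ C₂ × p ∈ C₂
                       × C ≡ (C₁ ∪ C₂) - p) )

data IteratedSeries (k : ℕ) : ∀ {n} → Matroid n → Set₁ where
  uniform : IteratedSeries k (U 1 k)
  iso     : {M : Matroid m} {N : Matroid n} →
            M ≅ N → IteratedSeries k M → IteratedSeries k N
  series  : {M₁ M₂ S : Matroid n} {p : Fin n} →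
            IteratedSeries k M₁ → IteratedSeries k M₂ →
            IsSeriesConnection M₁ M₂ p S → IteratedSeries k S

{-# OPTIONS --safe #-}
module Submission where

-- Peeling a cocircuit of size at most k − 1 off a proper restriction lowers the
-- rank, so ∣X∣ ≤ (k − 1) r(X) for every proper X; taking X = E − e gives the
-- bound.  If the bound is attained and r(M) ≥ 2, peeling E − e down to rank 1
-- leaves a parallel class T with k − 1 elements.  For t ∈ T, a smallest
-- cocircuit of M ∖ t together with t is a cocircuit of M with k elements, and it
-- contains T, so it is T ∪ {p}.  Then M / T is again minimally k-degenerate
-- attaining the bound, and M is the series connection at p of M / T and the
-- rank-1 uniform matroid on T ∪ {p}.  Conversely, a series connection adds ranks
-- and adds sizes up to one shared element.

open import Defs
open import Data.Bool.Base using (true; false)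
open import Data.Fin.Base using (Fin; zero; suc)
open import Data.Fin.Properties using (any?; injective⇒≤)
open import Data.Fin.Subset
open import Data.Fin.Subset.Properties
open import Data.List.Base using ([]; _∷_; map; filter)
open import Data.List.Extrema.Nat using (max; argmax-sel; v≤max⁺)
open import Data.List.Membership.Propositional using (lose) renaming (_∈_ to _∈ˡ_)
open import Data.List.Membership.Propositional.Properties
  using (∈-map⁺; ∈-map⁻; ∈-filter⁺; ∈-filter⁻; ∈-++⁺ˡ; ∈-++⁺ʳ)
open import Data.List.Relation.Unary.Any using (here)
open import Data.Nat.Base
  using (ℕ; zero; suc; _+_; _*_; _∸_; _≤_; _<_; NonZero; >-nonZero; z≤n; s≤s; s≤s⁻¹)
open import Data.Nat.Properties hiding (_≟_)
open import Data.Product using (∃-syntax; _×_; _,_; proj₁; proj₂)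
open import Data.Sum.Base using (_⊎_; inj₁; inj₂; [_,_]′)
open import Data.Vec.Base using ([]; _∷_; here; there; tabulate)
open import Data.Vec.Properties using (lookup∘tabulate; []=⇒lookup; lookup⇒[]=)
open import Data.Vec.Properties.WithK using ([]=-irrelevant)
open import Function.Base using (_∘_; id)
open import Function.Bundles
  using (_⇔_; mk⇔; Equivalence; _↔_; mk↔ₛ′; Inverse; Injection)
open import Function.Construct.Composition using (_↔-∘_)
open import Function.Properties.Inverse using (↔⇒↣; ↔-sym)
open import Relation.Binary.PropositionalEquality
  using (_≡_; refl; sym; trans; cong; cong₂; subst; module ≡-Reasoning)
open import Relation.Nullary using (Dec; ¬_; yes; no; does; proof; Reflects; invert; contradiction)
open import Relation.Nullary.Decidable using (_×-dec_; dec-true)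
open import Relation.Unary using (Decidable)

-- Independence is given for `M`, while the series connection is specified by its cocircuits only.
-- The common language is rank: a cocircuit is a minimal set whose removal from the ground set
-- lowers the rank, and sets of this kind are trimmed to cocircuits when needed. Contracting T
-- undoes a series connection with a rank-one matroid on T and `p`. It removes `c` = k - 1 elements
-- and one unit of rank, so equality in the bound persists. The cocircuits of the contraction are
-- the cocircuits of `M` that avoid T, so its cogirth cannot fall below k. The delicate point is
-- that its restrictions stay degenerate: the contraction measures a set X by the rank of X ∪ T in
-- `M`, and a set that lowers the rank of X need not lower that of X ∪ T. A set peeled off X ∪ T may
-- in turn meet T. The size of T settles that case: a cocircuit with at most `c` elements that meets
-- the parallel class T is T itself.

private
  variable
    m n : ℕ
    x y : Fin n
    p q s X Y Z C D T I J B : Subset n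

-- Differences, unions and sizes of finite subsets

x∈p─q⁻ : ∀ (p q : Subset n) → x ∈ p ─ q → x ∈ p × x ∉ q
x∈p─q⁻ (true ∷ p) (false ∷ q) here = here , λ ()
x∈p─q⁻ (true ∷ p) (true ∷ q) (there x∈) =
  let (a , b) = x∈p─q⁻ p q x∈ in there a , b ∘ drop-there
x∈p─q⁻ (true ∷ p) (false ∷ q) (there x∈) =
  let (a , b) = x∈p─q⁻ p q x∈ in there a , b ∘ drop-there
x∈p─q⁻ (false ∷ p) (true ∷ q) (there x∈) =
  let (a , b) = x∈p─q⁻ p q x∈ in there a , b ∘ drop-there
x∈p─q⁻ (false ∷ p) (false ∷ q) (there x∈) =
  let (a , b) = x∈p─q⁻ p q x∈ in there a , b ∘ drop-there

x∈p⇒⁅x⁆⊆p : x ∈ p → ⁅ x ⁆ ⊆ p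
x∈p⇒⁅x⁆⊆p {x = x} {p = p} x∈p y∈ = subst (_∈ p) (sym (x∈⁅y⁆⇒x≡y x y∈)) x∈p

∪-least : p ⊆ s → q ⊆ s → p ∪ q ⊆ s
∪-least {p = p} {q = q} p⊆s q⊆s x∈ = [ p⊆s , q⊆s ]′ (x∈p∪q⁻ p q x∈)

─-monoˡ : p ⊆ q → p ─ s ⊆ q ─ s
─-monoˡ {p = p} {s = s} p⊆q x∈ =
  let (a , b) = x∈p─q⁻ p s x∈ in x∈p∧x∉q⇒x∈p─q (p⊆q a) b

─-antiʳ : p ⊆ q → s ─ q ⊆ s ─ p
─-antiʳ {q = q} {s = s} p⊆q x∈ =
  let (a , b) = x∈p─q⁻ s q x∈ in x∈p∧x∉q⇒x∈p─q a (b ∘ p⊆q)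

∣p∪q∣+∣p∩q∣≡∣p∣+∣q∣ : ∀ (p q : Subset n) → ∣ p ∪ q ∣ + ∣ p ∩ q ∣ ≡ ∣ p ∣ + ∣ q ∣
∣p∪q∣+∣p∩q∣≡∣p∣+∣q∣ [] [] = refl
∣p∪q∣+∣p∩q∣≡∣p∣+∣q∣ (true ∷ p) (true ∷ q) = cong suc (begin
  ∣ p ∪ q ∣ + suc ∣ p ∩ q ∣   ≡⟨ +-suc _ _ ⟩
  suc (∣ p ∪ q ∣ + ∣ p ∩ q ∣) ≡⟨ cong suc (∣p∪q∣+∣p∩q∣≡∣p∣+∣q∣ p q) ⟩
  suc (∣ p ∣ + ∣ q ∣)         ≡⟨ +-suc _ _ ⟨
  ∣ p ∣ + suc ∣ q ∣           ∎)
  where open ≡-Reasoning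
∣p∪q∣+∣p∩q∣≡∣p∣+∣q∣ (true ∷ p) (false ∷ q) = cong suc (∣p∪q∣+∣p∩q∣≡∣p∣+∣q∣ p q)
∣p∪q∣+∣p∩q∣≡∣p∣+∣q∣ (false ∷ p) (true ∷ q) =
  trans (cong suc (∣p∪q∣+∣p∩q∣≡∣p∣+∣q∣ p q)) (sym (+-suc _ _))
∣p∪q∣+∣p∩q∣≡∣p∣+∣q∣ (false ∷ p) (false ∷ q) = ∣p∪q∣+∣p∩q∣≡∣p∣+∣q∣ p q

∣∪∣-disjoint : ∀ {p q : Subset n} → (∀ {x} → x ∈ p → x ∉ q) → ∣ p ∪ q ∣ ≡ ∣ p ∣ + ∣ q ∣
∣∪∣-disjoint {n = n} {p = p} {q = q} disj = begin
  ∣ p ∪ q ∣             ≡⟨ +-identityʳ _ ⟨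
  ∣ p ∪ q ∣ + 0         ≡⟨ cong (∣ p ∪ q ∣ +_) (trans (cong ∣_∣ (Empty-unique empty)) (∣⊥∣≡0 n)) ⟨
  ∣ p ∪ q ∣ + ∣ p ∩ q ∣ ≡⟨ ∣p∪q∣+∣p∩q∣≡∣p∣+∣q∣ p q ⟩
  ∣ p ∣ + ∣ q ∣         ∎
  where
  open ≡-Reasoning
  empty : Empty (p ∩ q)
  empty (x , x∈) = let (a , b) = x∈p∩q⁻ p q x∈ in disj a b

∣p∪⁅x⁆∣≡1+∣p∣ : x ∉ p → ∣ p ∪ ⁅ x ⁆ ∣ ≡ suc ∣ p ∣
∣p∪⁅x⁆∣≡1+∣p∣ {x = x} {p = p} x∉p = begin
  ∣ p ∪ ⁅ x ⁆ ∣     ≡⟨ ∣∪∣-disjoint (λ y∈p y∈x → x∉p (subst (_∈ p) (x∈⁅y⁆⇒x≡y x y∈x) y∈p)) ⟩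
  ∣ p ∣ + ∣ ⁅ x ⁆ ∣ ≡⟨ cong (∣ p ∣ +_) (∣⁅x⁆∣≡1 x) ⟩
  ∣ p ∣ + 1         ≡⟨ +-comm _ 1 ⟩
  suc ∣ p ∣         ∎
  where open ≡-Reasoning

p─q∪q≡p : q ⊆ p → (p ─ q) ∪ q ≡ p
p─q∪q≡p {q = q} {p = p} q⊆p = ⊆-antisym
  (∪-least (p─q⊆p p q) q⊆p)
  (λ {x} x∈p → x∈p∪q⁺ (case-∈ x x∈p))
  where
  case-∈ : ∀ x → x ∈ p → x ∈ p ─ q ⊎ x ∈ q
  case-∈ x x∈p with x ∈? q
  ... | yes x∈q = inj₂ x∈q
  ... | no x∉q = inj₁ (x∈p∧x∉q⇒x∈p─q x∈p x∉q)

∣p─q∣+∣q∣≡∣p∣ : q ⊆ p → ∣ p ─ q ∣ + ∣ q ∣ ≡ ∣ p ∣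
∣p─q∣+∣q∣≡∣p∣ {q = q} {p = p} q⊆p = trans
  (sym (∣∪∣-disjoint (λ x∈ → proj₂ (x∈p─q⁻ p q x∈))))
  (cong ∣_∣ (p─q∪q≡p q⊆p))

∣p-x∣ : x ∈ p → suc ∣ p - x ∣ ≡ ∣ p ∣
∣p-x∣ {x = x} {p = p} x∈p = begin
  suc ∣ p - x ∣           ≡⟨ +-comm 1 _ ⟩
  ∣ p - x ∣ + 1           ≡⟨ cong (∣ p - x ∣ +_) (∣⁅x⁆∣≡1 x) ⟨
  ∣ p - x ∣ + ∣ ⁅ x ⁆ ∣   ≡⟨ ∣p─q∣+∣q∣≡∣p∣ (x∈p⇒⁅x⁆⊆p x∈p) ⟩
  ∣ p ∣                   ∎
  where open ≡-Reasoning

⊆-by-size : p ⊆ q → ∣ q ∣ ≤ ∣ p ∣ → q ⊆ p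
⊆-by-size {p = p} p⊆q ∣q∣≤∣p∣ {x} x∈q with x ∈? p
... | yes x∈p = x∈p
... | no x∉p = contradiction ∣q∣≤∣p∣ (<⇒≱ (p⊂q⇒∣p∣<∣q∣ (p⊆q , x , x∈q , x∉p)))

0<∣p∣⇒Nonempty : 0 < ∣ p ∣ → Nonempty p
0<∣p∣⇒Nonempty {n} {p} 0<∣p∣ =
  let (x , x∈p , _) = larger⇒∃∉ ⊥ p (≤-trans (s≤s (≤-reflexive (∣⊥∣≡0 n))) 0<∣p∣) in x , x∈p

-- Largest members of decidable families of subsets

∈-allSubsets : (X : Subset n) → X ∈ˡ allSubsets n
∈-allSubsets [] = here refl
∈-allSubsets (true ∷ X) = ∈-++⁺ˡ (∈-map⁺ (true ∷_) (∈-allSubsets X))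
∈-allSubsets (false ∷ X) =
  ∈-++⁺ʳ (map (true ∷_) (allSubsets _)) (∈-map⁺ (false ∷_) (∈-allSubsets X))

maxSize : {P : Subset n → Set} → Decidable P → ℕ
maxSize {n} P? = max 0 (map ∣_∣ (filter P? (allSubsets n)))

module _ {n} {P : Subset n → Set} (P? : Decidable P) where

  ∣∣≤maxSize : P X → ∣ X ∣ ≤ maxSize P?
  ∣∣≤maxSize {X} pX = v≤max⁺ 0 _
    (inj₂ (lose (∈-map⁺ ∣_∣ (∈-filter⁺ P? (∈-allSubsets X) pX)) ≤-refl))

  maxSize-attained : P ⊥ → ∃[ X ] P X × ∣ X ∣ ≡ maxSize P?
  maxSize-attained p⊥ with argmax-sel id 0 (map ∣_∣ (filter P? (allSubsets n)))
  -- The default value 0 of the maximum is also the size of `⊥`, which has the property.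
  ... | inj₁ eq = ⊥ , p⊥ , trans (∣⊥∣≡0 n) (sym eq)
  ... | inj₂ max∈ =
    let (X , X∈ , eq) = ∈-map⁻ ∣_∣ max∈
    in X , proj₂ (∈-filter⁻ P? {xs = allSubsets n} X∈) , sym eq

-- The rank function of a matroid

rk : Matroid n → Subset n → ℕ
rk M X = maxSize (λ I → (I ⊆? X) ×-dec indep? M I)

module Rank {n} (M : Matroid n) where

  ∣∣≤rk : I ⊆ X → Indep M I → ∣ I ∣ ≤ rk M X
  ∣∣≤rk {X = X} I⊆X i = ∣∣≤maxSize (λ I → (I ⊆? X) ×-dec indep? M I) ((λ {x} → I⊆X {x}) , i)

  ∣∣≤rank : Indep M I → ∣ I ∣ ≤ rank M
  ∣∣≤rank = ∣∣≤maxSize (indep? M)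

  rk-attained : ∀ X → ∃[ I ] I ⊆ X × Indep M I × ∣ I ∣ ≡ rk M X
  rk-attained X =
    let (I , (I⊆X , i) , eq) = maxSize-attained (λ I → (I ⊆? X) ×-dec indep? M I)
                                                (⊥⊆ , indep-⊥ M)
    in I , I⊆X , i , eq

  rk-least : ∀ {b} → (∀ {I} → I ⊆ X → Indep M I → ∣ I ∣ ≤ b) → rk M X ≤ b
  rk-least {X} bound = let (I , I⊆X , i , eq) = rk-attained X in
    ≤-trans (≤-reflexive (sym eq)) (bound I⊆X i)

  rk≤∣∣ : rk M X ≤ ∣ X ∣
  rk≤∣∣ = rk-least (λ I⊆X _ → p⊆q⇒∣p∣≤∣q∣ I⊆X)

  rk-mono : X ⊆ Y → rk M X ≤ rk M Y
  rk-mono X⊆Y = rk-least (λ I⊆X i → ∣∣≤rk (X⊆Y ∘ I⊆X) i)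

  rank≡rk : rank M ≡ rk M (E M)
  rank≡rk = ≤-antisym
    (let (I , i , eq) = maxSize-attained (indep? M) (indep-⊥ M) in
      ≤-trans (≤-reflexive (sym eq)) (∣∣≤rk (indep⊆E M i) i))
    (rk-least (λ _ → ∣∣≤rank))

  rk≤rank : rk M X ≤ rank M
  rk≤rank = rk-least (λ _ → ∣∣≤rank)

  extend : I ⊆ X → Indep M I → ∃[ J ] I ⊆ J × J ⊆ X × Indep M J × ∣ J ∣ ≡ rk M X
  extend {I} {X} I⊆X i = go (rk M X ∸ ∣ I ∣) I⊆X i (m+[n∸m]≡n (∣∣≤rk I⊆X i))
    where
    -- The counter `d` is the exact deficit of `I` against the rank of `X`. Augmenting from a
    -- largest independent subset of `X` keeps the result inside `X`.
    go : ∀ d {I} → I ⊆ X → Indep M I → ∣ I ∣ + d ≡ rk M X →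
         ∃[ J ] I ⊆ J × J ⊆ X × Indep M J × ∣ J ∣ ≡ rk M X
    go zero {I} I⊆X i eq = I , id , I⊆X , i , trans (sym (+-identityʳ _)) eq
    go (suc d) {I} I⊆X i eq =
      let (K , K⊆X , iK , ∣K∣) = rk-attained X
          I<K = ≤-trans (m<m+n ∣ I ∣ (s≤s z≤n)) (≤-reflexive (trans eq (sym ∣K∣)))
          (e , e∈K , e∉I , i′) = augment M i iK I<K
          (J , I′⊆J , rest) = go d (∪-least I⊆X (x∈p⇒⁅x⁆⊆p (K⊆X e∈K))) i′
            (trans (cong (_+ d) (∣p∪⁅x⁆∣≡1+∣p∣ e∉I)) (trans (sym (+-suc _ d)) eq))
      in J , I′⊆J ∘ p⊆p∪q ⁅ e ⁆ , rest

  -- Extend a basis `I` of the intersection to a basis `J` of the union. The parts of `J` in `X` and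
  -- in `Y` are independent, cover `J` and share all of `I`.
  rk-submodular : ∀ X Y → rk M (X ∪ Y) + rk M (X ∩ Y) ≤ rk M X + rk M Y
  rk-submodular X Y =
    let (I , I⊆ , i , ∣I∣) = rk-attained (X ∩ Y)
        (J , I⊆J , J⊆ , j , ∣J∣) = extend (p⊆p∪q Y ∘ proj₁ ∘ x∈p∩q⁻ X Y ∘ I⊆) i
    in begin
      rk M (X ∪ Y) + rk M (X ∩ Y)
        ≡⟨ cong₂ _+_ ∣J∣ ∣I∣ ⟨
      ∣ J ∣ + ∣ I ∣
        ≤⟨ +-mono-≤
             (p⊆q⇒∣p∣≤∣q∣ (λ x∈J → x∈p∪q⁺ ([ (λ x∈X → inj₁ (x∈p∩q⁺ (x∈J , x∈X)))
                                            , (λ x∈Y → inj₂ (x∈p∩q⁺ (x∈J , x∈Y))) ]′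
                                           (x∈p∪q⁻ X Y (J⊆ x∈J)))))
             (p⊆q⇒∣p∣≤∣q∣ (λ x∈I → let (a , b) = x∈p∩q⁻ X Y (I⊆ x∈I) in
               x∈p∩q⁺ (x∈p∩q⁺ (I⊆J x∈I , a) , x∈p∩q⁺ (I⊆J x∈I , b)))) ⟩
      ∣ (J ∩ X) ∪ (J ∩ Y) ∣ + ∣ (J ∩ X) ∩ (J ∩ Y) ∣
        ≡⟨ ∣p∪q∣+∣p∩q∣≡∣p∣+∣q∣ (J ∩ X) (J ∩ Y) ⟩
      ∣ J ∩ X ∣ + ∣ J ∩ Y ∣
        ≤⟨ +-mono-≤ (∣∣≤rk (p∩q⊆q J X) (indep-⊆ M (p∩q⊆p J X) j))
                    (∣∣≤rk (p∩q⊆q J Y) (indep-⊆ M (p∩q⊆p J Y) j)) ⟩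
      rk M X + rk M Y ∎
    where open ≤-Reasoning

  rk-subadditive : ∀ X Y → rk M (X ∪ Y) ≤ rk M X + rk M Y
  rk-subadditive X Y = ≤-trans (m≤m+n _ _) (rk-submodular X Y)

  rk-∪⁅⁆ : ∀ X x → rk M (X ∪ ⁅ x ⁆) ≤ suc (rk M X)
  rk-∪⁅⁆ X x = begin
    rk M (X ∪ ⁅ x ⁆)     ≤⟨ rk-subadditive X ⁅ x ⁆ ⟩
    rk M X + rk M ⁅ x ⁆  ≤⟨ +-monoʳ-≤ (rk M X) rk≤∣∣ ⟩
    rk M X + ∣ ⁅ x ⁆ ∣   ≡⟨ cong (rk M X +_) (∣⁅x⁆∣≡1 x) ⟩
    rk M X + 1           ≡⟨ +-comm _ 1 ⟩
    suc (rk M X)         ∎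
    where open ≤-Reasoning

  -- A set of rank at most 1 lies in the closure of each of its non-loops.
  rk-∪-parallel : rk M T ≤ 1 → x ∈ T → Indep M ⁅ x ⁆ → x ∈ Z → rk M (Z ∪ T) ≤ rk M Z
  rk-∪-parallel {T} {x} {Z} rkT x∈T ix x∈Z = +-cancelʳ-≤ 1 _ _ (begin
    rk M (Z ∪ T) + 1            ≤⟨ +-monoʳ-≤ _ one≤ ⟩
    rk M (Z ∪ T) + rk M (Z ∩ T) ≤⟨ rk-submodular Z T ⟩
    rk M Z + rk M T             ≤⟨ +-monoʳ-≤ _ rkT ⟩
    rk M Z + 1                  ∎)
    where
    open ≤-Reasoning
    one≤ : 1 ≤ rk M (Z ∩ T)
    one≤ = ≤-trans (≤-reflexive (sym (∣⁅x⁆∣≡1 x)))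
                   (∣∣≤rk (x∈p⇒⁅x⁆⊆p (x∈p∩q⁺ (x∈Z , x∈T))) ix)

  basis⇒∣∣≡rank : IsBasis M B → ∣ B ∣ ≡ rank M
  basis⇒∣∣≡rank {B} (i , maximal) = ≤-antisym (∣∣≤rank i) (begin
    rank M       ≡⟨ rank≡rk ⟩
    rk M (E M)   ≡⟨ sym ∣J∣ ⟩
    ∣ proj₁ ext ∣ ≤⟨ p⊆q⇒∣p∣≤∣q∣ (maximal j B⊆J) ⟩
    ∣ B ∣        ∎)
    where
    open ≤-Reasoning
    ext = extend (indep⊆E M i) i
    B⊆J : B ⊆ proj₁ ext
    B⊆J = proj₁ (proj₂ ext)
    j = proj₁ (proj₂ (proj₂ (proj₂ ext)))
    ∣J∣ = proj₂ (proj₂ (proj₂ (proj₂ ext)))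

  indep⇒basis : Indep M B → rank M ≤ ∣ B ∣ → IsBasis M B
  indep⇒basis i r≤ = i , λ i′ B⊆I → ⊆-by-size B⊆I (≤-trans (∣∣≤rank i′) r≤)

  -- Coindependence, cocircuits and cogirth through the rank of complements

  coindep⇒rk : Coindep M X → rank M ≤ rk M (E M ─ X)
  coindep⇒rk {X} (B , b , X⊆) = ≤-trans (≤-reflexive (sym (basis⇒∣∣≡rank b)))
    (∣∣≤rk (λ x∈B → x∈p∧x∉q⇒x∈p─q (indep⊆E M (proj₁ b) x∈B)
                      (λ x∈X → proj₂ (x∈p─q⁻ (E M) B (X⊆ x∈X)) x∈B))
           (proj₁ b))

  rk⇒coindep : X ⊆ E M → rank M ≤ rk M (E M ─ X) → Coindep M X
  rk⇒coindep {X} X⊆E r≤ =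
    let (B , B⊆ , i , eq) = rk-attained (E M ─ X)
    in B , indep⇒basis i (≤-trans r≤ (≤-reflexive (sym eq))) ,
       λ x∈X → x∈p∧x∉q⇒x∈p─q (X⊆E x∈X) (λ x∈B → proj₂ (x∈p─q⁻ (E M) X (B⊆ x∈B)) x∈X)

  cocircuit-rk : IsCocircuit M C → rk M (E M ─ C) < rank M
  cocircuit-rk (C⊆E , ¬co , _) = ≰⇒> (¬co ∘ rk⇒coindep C⊆E)

  cocircuit-min : IsCocircuit M C → X ⊆ C → rk M (E M ─ X) < rank M → C ⊆ X
  cocircuit-min {X = X} (C⊆E , _ , minimal) X⊆C r< {x} x∈C with x ∈? X
  ... | yes x∈X = x∈X
  ... | no x∉X = contradiction (coindep⇒rk (minimal (X⊆C , x , x∈C , x∉X))) (<⇒≱ r<)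

  cocircuit-∌ : IsCocircuit M C → x ∈ C → rank M ≤ rk M (E M ─ (C - x))
  cocircuit-∌ {x = x} (_ , _ , minimal) x∈C =
    coindep⇒rk (minimal (x∈p⇒p-x⊂p x∈C))

  mkCocircuit : C ⊆ E M → rk M (E M ─ C) < rank M →
                (∀ {D} → D ⊆ C → rk M (E M ─ D) < rank M → C ⊆ D) → IsCocircuit M C
  mkCocircuit C⊆E r< minimal =
    C⊆E , (λ co → <⇒≱ r< (coindep⇒rk co)) ,
    λ { {D} (D⊆C , x , x∈C , x∉D) → rk⇒coindep (C⊆E ∘ D⊆C)
          (≮⇒≥ (λ D< → x∉D (minimal D⊆C D< x∈C))) }

  cocircuit⊆ : X ⊆ E M → rk M (E M ─ X) < rank M → ∃[ C ] IsCocircuit M C × C ⊆ X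
  cocircuit⊆ {X} = go (suc ∣ X ∣) ≤-refl
    where
    go : ∀ d {X} → ∣ X ∣ < d → X ⊆ E M → rk M (E M ─ X) < rank M →
         ∃[ C ] IsCocircuit M C × C ⊆ X
    go (suc d) {X} ∣X∣<d X⊆E r<
      with any? (λ x → (x ∈? X) ×-dec (rk M (E M ─ (X - x)) <? rank M))
    ... | yes (x , x∈X , r<′) =
      let (C , cC , C⊆) = go d (≤-trans (x∈p⇒∣p-x∣<∣p∣ x∈X) (s≤s⁻¹ ∣X∣<d))
                             (X⊆E ∘ p─q⊆p X ⁅ x ⁆) r<′
      in C , cC , p─q⊆p X ⁅ x ⁆ ∘ C⊆
    ... | no none = X , mkCocircuit X⊆E r< minimal , id
      where
      minimal : ∀ {D} → D ⊆ X → rk M (E M ─ D) < rank M → X ⊆ D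
      minimal {D} D⊆X D< {x} x∈X with x ∈? D
      ... | yes x∈D = x∈D
      -- A set `D` that misses `x` lies in `X - x`, so by monotonicity `x` alone could already be
      -- removed from `X`. Testing single deletions therefore suffices for minimality.
      ... | no x∉D = contradiction
        (x , x∈X , ≤-trans (s≤s (rk-mono (─-antiʳ (λ {y} y∈D →
           x∈p∧x≢y⇒x∈p-y (D⊆X y∈D) (λ y≡x → x∉D (subst (_∈ D) y≡x y∈D)))))) D<)
        none

  -- The complements of `C` and `D` are hyperplanes, and `y` makes their union spanning. By
  -- submodularity their intersection has rank at least two below that of `M`, so putting `x` back
  -- still leaves it non-spanning.
  cocircuit-elimination : IsCocircuit M C → IsCocircuit M D → y ∈ D → y ∉ C →
                          x ∈ C → x ∈ D → rk M (E M ─ ((C ∪ D) - x)) < rank M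
  cocircuit-elimination {C} {D} {y} {x} cC cD y∈D y∉C x∈C x∈D = ≤-trans (s≤s (begin
    rk M (E M ─ ((C ∪ D) - x))          ≤⟨ rk-mono flat⊆ ⟩
    rk M (((E M ─ C) ∩ (E M ─ D)) ∪ ⁅ x ⁆) ≤⟨ rk-∪⁅⁆ _ x ⟩
    suc (rk M ((E M ─ C) ∩ (E M ─ D)))  ≤⟨ +-cancelˡ-≤ (rank M) _ _ (begin
       rank M + suc (rk M ((E M ─ C) ∩ (E M ─ D)))
         ≡⟨ +-suc _ _ ⟩
       suc (rank M + rk M ((E M ─ C) ∩ (E M ─ D)))
         ≤⟨ s≤s (+-monoˡ-≤ _ (≤-trans (cocircuit-∌ cD y∈D) (rk-mono ⊆∪))) ⟩
       suc (rk M ((E M ─ C) ∪ (E M ─ D)) + rk M ((E M ─ C) ∩ (E M ─ D)))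
         ≤⟨ s≤s (rk-submodular (E M ─ C) (E M ─ D)) ⟩
       suc (rk M (E M ─ C)) + rk M (E M ─ D)
         ≤⟨ +-monoˡ-≤ _ (cocircuit-rk cC) ⟩
       rank M + rk M (E M ─ D) ∎) ⟩
    rk M (E M ─ D) ∎)) (cocircuit-rk cD)
    where
    open ≤-Reasoning
    ⊆∪ : E M ─ (D - y) ⊆ (E M ─ C) ∪ (E M ─ D)
    ⊆∪ {z} z∈ with x∈p─q⁻ (E M) (D - y) z∈ | z ∈? D
    ... | z∈E , z∉ | no z∉D = x∈p∪q⁺ (inj₂ (x∈p∧x∉q⇒x∈p─q z∈E z∉D))
    ... | z∈E , z∉ | yes z∈D = x∈p∪q⁺ (inj₁ (x∈p∧x∉q⇒x∈p─q z∈E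
      (λ z∈C → z∉ (x∈p∧x≢y⇒x∈p-y z∈D (λ { refl → y∉C z∈C })))))
    flat⊆ : E M ─ ((C ∪ D) - x) ⊆ ((E M ─ C) ∩ (E M ─ D)) ∪ ⁅ x ⁆
    flat⊆ {z} z∈ with x∈p─q⁻ (E M) ((C ∪ D) - x) z∈ | z ∈? ⁅ x ⁆
    ... | z∈E , z∉ | yes z∈x = x∈p∪q⁺ (inj₂ z∈x)
    ... | z∈E , z∉ | no z∉x = x∈p∪q⁺ (inj₁ (x∈p∩q⁺
      ( x∈p∧x∉q⇒x∈p─q z∈E (λ z∈C → z∉ (x∈p∧x∉q⇒x∈p─q (x∈p∪q⁺ (inj₁ z∈C)) z∉x))
      , x∈p∧x∉q⇒x∈p─q z∈E (λ z∈D → z∉ (x∈p∧x∉q⇒x∈p─q (x∈p∪q⁺ (inj₂ z∈D)) z∉x)) )))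

  -- A set of least size with non-spanning complement is automatically a cocircuit, and a smallest
  -- one. Descending in size from `X` thus produces the cogirth together with the bound on it.
  cogirth⊆ : X ⊆ E M → rk M (E M ─ X) < rank M → ∃[ g ] IsCogirth M g × g ≤ ∣ X ∣
  cogirth⊆ {X} = go (suc ∣ X ∣) ≤-refl
    where
    go : ∀ d {X} → ∣ X ∣ < d → X ⊆ E M → rk M (E M ─ X) < rank M →
         ∃[ g ] IsCogirth M g × g ≤ ∣ X ∣
    go (suc d) {X} ∣X∣<d X⊆E r<
      with anySubset? (λ Y → (Y ⊆? E M) ×-dec (rk M (E M ─ Y) <? rank M)
                             ×-dec (∣ Y ∣ <? ∣ X ∣))
    ... | yes (Y , Y⊆E , Y< , lt) =
      let (g , cog , g≤) = go d (≤-trans lt (s≤s⁻¹ ∣X∣<d)) Y⊆E Y<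
      in g , cog , ≤-trans g≤ (<⇒≤ lt)
    ... | no none = ∣ X ∣ ,
      ((X , mkCocircuit X⊆E r< (λ D⊆X D< →
             ⊆-by-size D⊆X (≮⇒≥ (λ lt → none (_ , X⊆E ∘ D⊆X , D< , lt)))) , refl) ,
       λ cC → ≮⇒≥ (λ lt → none (_ , proj₁ cC , cocircuit-rk cC , lt))) ,
      ≤-refl

open Rank

-- Restriction, contraction and parallel classes

rk-restrict≤ : (M : Matroid n) (X⊆E : X ⊆ E M) → rk (restrict M X⊆E) Y ≤ rk M Y
rk-restrict≤ M X⊆E =
  rk-least (restrict M X⊆E) (λ I⊆Y (_ , i) → ∣∣≤rk M I⊆Y i)

rk≤rk-restrict : (M : Matroid n) (X⊆E : X ⊆ E M) → Y ⊆ X →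
                 rk M Y ≤ rk (restrict M X⊆E) Y
rk≤rk-restrict M X⊆E Y⊆X =
  rk-least M (λ I⊆Y i → ∣∣≤rk (restrict M X⊆E) I⊆Y ((λ {x} x∈ → Y⊆X (I⊆Y x∈)) , i))

-- Removing `C` and `x` from the ground set lowers the rank, so `C ∪ ⁅ x ⁆` contains a cocircuit. It
-- has at most `suc c` elements and every cocircuit has at least that many, so the two coincide.
-- This serves both for the matroid itself and for its contraction.
cocircuit-through : (M : Matroid n) → ∀ {c} → (∀ {C} → IsCocircuit M C → suc c ≤ ∣ C ∣) →
  x ∈ E M → C ⊆ E M - x → ∣ C ∣ ≤ c → rk M ((E M - x) ─ C) < rk M (E M - x) →
  ∃[ D ] IsCocircuit M D × x ∈ D × ∣ D ∣ ≡ suc c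
cocircuit-through {x = x} {C = C} M {c} large x∈E C⊆ ∣C∣≤c r< =
  let (D , cD , D⊆) = cocircuit⊆ M {C ∪ ⁅ x ⁆} C∪x⊆E
        (≤-trans (s≤s (≤-reflexive (cong (rk M) eq))) (≤-trans r< (rk≤rank M)))
      D⊇ = ⊆-by-size D⊆ (≤-trans ∣C∪x∣≤ (large cD))
  in D , cD , D⊇ (q⊆p∪q C ⁅ x ⁆ (x∈⁅x⁆ x)) ,
     ≤-antisym (≤-trans (p⊆q⇒∣p∣≤∣q∣ D⊆) ∣C∪x∣≤) (large cD)
  where
  C∪x⊆E : C ∪ ⁅ x ⁆ ⊆ E M
  C∪x⊆E = ∪-least (λ y∈ → p─q⊆p (E M) ⁅ x ⁆ (C⊆ y∈)) (x∈p⇒⁅x⁆⊆p x∈E)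
  eq : E M ─ (C ∪ ⁅ x ⁆) ≡ E M ─ ⁅ x ⁆ ─ C
  eq = trans (cong (E M ─_) (∪-comm C ⁅ x ⁆)) (sym (p─q─r≡p─q∪r (E M) ⁅ x ⁆ C))
  ∣C∪x∣≤ : ∣ C ∪ ⁅ x ⁆ ∣ ≤ suc c
  ∣C∪x∣≤ = ≤-trans (∣p∪⁅x⁆∣≤1+∣p∣ C x) (s≤s ∣C∣≤c)

-- For T of rank 1 this is M / T, a basis of T being ⁅ t ⁆; in general it is
-- M / t with the rest of T deleted.
contract : (M : Matroid n) (T : Subset n) {t : Fin n} → t ∈ T → Indep M ⁅ t ⁆ → Matroid n
contract M T {t} t∈T it = record
  { E       = E M ─ T
  ; Indep   = λ I → I ⊆ E M ─ T × Indep M (I ∪ ⁅ t ⁆)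
  ; indep?  = λ I → (I ⊆? (E M ─ T)) ×-dec indep? M (I ∪ ⁅ t ⁆)
  ; indep⊆E = proj₁
  ; indep-⊥ = ⊥⊆ , subst (Indep M) (sym (∪-identityˡ ⁅ t ⁆)) it
  ; indep-⊆ = λ { I⊆J (J⊆ , j) → J⊆ ∘ I⊆J ,
                  indep-⊆ M (∪-least (p⊆p∪q ⁅ t ⁆ ∘ I⊆J) (q⊆p∪q _ ⁅ t ⁆)) j }
  ; augment = λ {I} {J} (I⊆ , i) (J⊆ , j) I<J →
      let (e , e∈ , e∉ , i′) = augment M i j (begin-strict
            ∣ I ∪ ⁅ t ⁆ ∣ ≡⟨ ∣p∪⁅x⁆∣≡1+∣p∣ (t∉ I⊆) ⟩
            suc ∣ I ∣     <⟨ s≤s I<J ⟩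
            suc ∣ J ∣     ≡⟨ ∣p∪⁅x⁆∣≡1+∣p∣ (t∉ J⊆) ⟨
            ∣ J ∪ ⁅ t ⁆ ∣ ∎)
          e∈J = [ id , (λ e∈t → contradiction (q⊆p∪q I ⁅ t ⁆ e∈t) e∉) ]′ (x∈p∪q⁻ J ⁅ t ⁆ e∈)
      in e , e∈J , e∉ ∘ p⊆p∪q ⁅ t ⁆ ,
         (λ x∈ → ∪-least {p = I} {q = ⁅ e ⁆} I⊆ (x∈p⇒⁅x⁆⊆p (J⊆ e∈J)) x∈) ,
         indep-⊆ M (∪-least {p = I ∪ ⁅ e ⁆} {q = ⁅ t ⁆}
                      (∪-least {p = I} {q = ⁅ e ⁆} (p⊆p∪q ⁅ e ⁆ ∘ p⊆p∪q ⁅ t ⁆) (q⊆p∪q _ ⁅ e ⁆))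
                      (p⊆p∪q ⁅ e ⁆ ∘ q⊆p∪q I ⁅ t ⁆)) i′
  }
  where
  open ≤-Reasoning
  t∉ : I ⊆ E M ─ T → t ∉ I
  t∉ I⊆ t∈I = proj₂ (x∈p─q⁻ (E M) T (I⊆ t∈I)) t∈T

-- If some `u` in `T` were left outside `C`, its closure would contain all of `T`, so returning `x`
-- to `Y ─ C` would not raise the rank, against minimality. The ground set `Y` is kept general
-- because both the whole matroid and a restriction occur.
minimal-absorbs-parallel : (M : Matroid n) {Y C T : Subset n} →
  rk M (Y ─ C) < rk M Y → (∀ {D} → D ⊂ C → rk M Y ≤ rk M (Y ─ D)) →
  T ⊆ Y → rk M T ≤ 1 → (∀ {u} → u ∈ T → Indep M ⁅ u ⁆) → x ∈ C → x ∈ T → T ⊆ C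
minimal-absorbs-parallel {x = x} M {Y} {C} {T} r< minimal T⊆Y rkT loopless x∈C x∈T {u} u∈T
  with u ∈? C
... | yes u∈C = u∈C
... | no u∉C = contradiction (begin
    rk M Y               ≤⟨ minimal (x∈p⇒p-x⊂p x∈C) ⟩
    rk M (Y ─ (C - x))   ≤⟨ rk-mono M ⊆∪ ⟩
    rk M ((Y ─ C) ∪ T)   ≤⟨ rk-∪-parallel M rkT u∈T (loopless u∈T)
                             (x∈p∧x∉q⇒x∈p─q (T⊆Y u∈T) u∉C) ⟩
    rk M (Y ─ C)         ∎) (<⇒≱ r<)
  where
  open ≤-Reasoning
  ⊆∪ : Y ─ (C - x) ⊆ (Y ─ C) ∪ T
  ⊆∪ {z} z∈ with x∈p─q⁻ Y (C - x) z∈ | z ∈? C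
  ... | z∈Y , z∉ | no z∉C = x∈p∪q⁺ (inj₁ (x∈p∧x∉q⇒x∈p─q z∈Y z∉C))
  ... | z∈Y , z∉ | yes z∈C = x∈p∪q⁺ (inj₂ (in-T z∈C z∉))
    where
    in-T : z ∈ C → z ∉ C - x → z ∈ T
    in-T z∈C z∉ with z ∈? ⁅ x ⁆
    ... | yes z∈x = x∈p⇒⁅x⁆⊆p x∈T z∈x
    ... | no z∉x = contradiction (x∈p∧x∉q⇒x∈p─q z∈C z∉x) z∉

module Contraction {n} (M : Matroid n) {T : Subset n} (T⊆E : T ⊆ E M) (rkT : rk M T ≤ 1)
                   {t : Fin n} (t∈T : t ∈ T) (it : Indep M ⁅ t ⁆) where

  N : Matroid n
  N = contract M T t∈T it

  private
    t∉ : Y ⊆ E N → t ∉ Y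
    t∉ Y⊆ t∈Y = proj₂ (x∈p─q⁻ (E M) T (Y⊆ t∈Y)) t∈T

  -- The usual contraction formula for a set `T` of rank 1, with `suc` in place of a subtraction.
  -- One direction adds `t` to an independent set, the other removes it from a basis of `Y ∪ ⁅ t ⁆`,
  -- whose closure contains `T`.
  rk-contract : Y ⊆ E N → suc (rk N Y) ≡ rk M (Y ∪ T)
  rk-contract {Y} Y⊆ = ≤-antisym
    (let (I , I⊆Y , (I⊆ , i) , ∣I∣) = rk-attained N Y in begin
      suc (rk N Y)  ≡⟨ cong suc ∣I∣ ⟨
      suc ∣ I ∣     ≡⟨ ∣p∪⁅x⁆∣≡1+∣p∣ (t∉ I⊆) ⟨
      ∣ I ∪ ⁅ t ⁆ ∣ ≤⟨ ∣∣≤rk M (∪-least (p⊆p∪q T ∘ I⊆Y) (q⊆p∪q Y T ∘ x∈p⇒⁅x⁆⊆p t∈T)) i ⟩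
      rk M (Y ∪ T)  ∎)
    (let (J , t⊆J , J⊆ , j , ∣J∣) = extend M (q⊆p∪q Y ⁅ t ⁆) it
         t∈J = t⊆J (x∈⁅x⁆ t)
         J-t⊆Y : J - t ⊆ Y
         J-t⊆Y x∈ = let (a , b) = x∈p─q⁻ J ⁅ t ⁆ x∈ in
           [ id , (λ x∈t → contradiction x∈t b) ]′ (x∈p∪q⁻ Y ⁅ t ⁆ (J⊆ a))
     in begin
      rk M (Y ∪ T)           ≤⟨ rk-mono M (∪-least (p⊆p∪q T ∘ p⊆p∪q ⁅ t ⁆) (q⊆p∪q (Y ∪ ⁅ t ⁆) T)) ⟩
      rk M ((Y ∪ ⁅ t ⁆) ∪ T) ≤⟨ rk-∪-parallel M rkT t∈T it (q⊆p∪q Y ⁅ t ⁆ (x∈⁅x⁆ t)) ⟩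
      rk M (Y ∪ ⁅ t ⁆)       ≡⟨ ∣J∣ ⟨
      ∣ J ∣                  ≡⟨ ∣p-x∣ t∈J ⟨
      suc ∣ J - t ∣          ≤⟨ s≤s (∣∣≤rk N J-t⊆Y
                                  ( (λ x∈ → Y⊆ (J-t⊆Y x∈))
                                  , subst (Indep M) (sym (p─q∪q≡p (x∈p⇒⁅x⁆⊆p t∈J))) j)) ⟩
      suc (rk N Y)           ∎)
    where open ≤-Reasoning

  -- As `C` misses `T`, its complement in `M` is its complement in the contraction together with
  -- `T`. Rank drops therefore correspond, and with them the cocircuits that avoid `T`.
  rk-contract-─ : C ⊆ E N → suc (rk N (E N ─ C)) ≡ rk M (E M ─ C)
  rk-contract-─ {C} C⊆ = trans (rk-contract (p─q⊆p (E N) C))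
    (cong (rk M) (⊆-antisym
      (∪-least (─-monoˡ (p─q⊆p (E M) T))
               (λ x∈T → x∈p∧x∉q⇒x∈p─q (T⊆E x∈T) (λ x∈C → proj₂ (x∈p─q⁻ (E M) T (C⊆ x∈C)) x∈T)))
      ⊇))
    where
    ⊇ : E M ─ C ⊆ (E N ─ C) ∪ T
    ⊇ {x} x∈ with x∈p─q⁻ (E M) C x∈ | x ∈? T
    ... | _ | yes x∈T = q⊆p∪q _ T x∈T
    ... | x∈E , x∉C | no x∉T =
      p⊆p∪q T (x∈p∧x∉q⇒x∈p─q (x∈p∧x∉q⇒x∈p─q x∈E x∉T) x∉C)

  rank-contract : suc (rank N) ≡ rank M
  rank-contract = begin
    suc (rank N)         ≡⟨ cong suc (rank≡rk N) ⟩
    suc (rk N (E N))     ≡⟨ cong (suc ∘ rk N) (p─⊥≡p (E N)) ⟨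
    suc (rk N (E N ─ ⊥)) ≡⟨ rk-contract-─ {⊥} ⊥⊆ ⟩
    rk M (E M ─ ⊥)       ≡⟨ cong (rk M) (p─⊥≡p (E M)) ⟩
    rk M (E M)           ≡⟨ rank≡rk M ⟨
    rank M               ∎
    where open ≡-Reasoning

  non-spanning⁺ : C ⊆ E N → rk N (E N ─ C) < rank N → rk M (E M ─ C) < rank M
  non-spanning⁺ {C} C⊆ r< = begin-strict
    rk M (E M ─ C)       ≡⟨ rk-contract-─ C⊆ ⟨
    suc (rk N (E N ─ C)) <⟨ s≤s r< ⟩
    suc (rank N)         ≡⟨ rank-contract ⟩
    rank M               ∎
    where open ≤-Reasoning

  non-spanning⁻ : C ⊆ E N → rk M (E M ─ C) < rank M → rk N (E N ─ C) < rank N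
  non-spanning⁻ {C} C⊆ r< = s≤s⁻¹ (begin-strict
    suc (rk N (E N ─ C)) ≡⟨ rk-contract-─ C⊆ ⟩
    rk M (E M ─ C)       <⟨ r< ⟩
    rank M               ≡⟨ rank-contract ⟨
    suc (rank N)         ∎)
    where open ≤-Reasoning

  cocircuit⁺ : IsCocircuit N C → IsCocircuit M C
  cocircuit⁺ cC = mkCocircuit M (λ x∈ → p─q⊆p (E M) T (proj₁ cC x∈))
    (non-spanning⁺ (proj₁ cC) (cocircuit-rk N cC))
    (λ D⊆C D< → cocircuit-min N cC D⊆C (non-spanning⁻ (λ x∈ → proj₁ cC (D⊆C x∈)) D<))

  cocircuit⁻ : C ⊆ E N → IsCocircuit M C → IsCocircuit N C
  cocircuit⁻ C⊆ cC = mkCocircuit N C⊆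
    (non-spanning⁻ C⊆ (cocircuit-rk M cC))
    (λ D⊆C D< → cocircuit-min M cC D⊆C (non-spanning⁺ (C⊆ ∘ D⊆C) D<))

-- A copy of a rank-one uniform matroid inside the given universe: both parts of a series connection
-- live over the same `Fin n`.
rank1 : Subset n → Matroid n
rank1 {n} X = restrict (U 1 n) {X} ⊆⊤

module _ {n} {X : Subset n} {x : Fin n} (x∈X : x ∈ X) where

  private
    1≤rk : y ∈ Y → Y ⊆ X → 1 ≤ rk (rank1 X) Y
    1≤rk {y} y∈Y Y⊆X = ≤-trans (≤-reflexive (sym (∣⁅x⁆∣≡1 y)))
      (∣∣≤rk (rank1 X) (x∈p⇒⁅x⁆⊆p y∈Y) (x∈p⇒⁅x⁆⊆p (Y⊆X y∈Y) , ≤-reflexive (∣⁅x⁆∣≡1 y)))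

    rank≡1 : rank (rank1 X) ≡ 1
    rank≡1 = trans (rank≡rk (rank1 X)) (≤-antisym (rk-least (rank1 X) (λ _ → proj₂)) (1≤rk x∈X id))

    spanning : rk (rank1 X) (X ─ C) < rank (rank1 X) → X ⊆ C
    spanning {C} r< {y} y∈X with y ∈? C
    ... | yes y∈C = y∈C
    ... | no y∉C = contradiction (≤-trans r< (≤-reflexive rank≡1))
      (<⇒≱ (s≤s (1≤rk (x∈p∧x∉q⇒x∈p─q y∈X y∉C) (p─q⊆p X C))))

  cocircuit-rank1 : IsCocircuit (rank1 X) X
  cocircuit-rank1 = mkCocircuit (rank1 X) id (begin-strict
    rk (rank1 X) (X ─ X) ≤⟨ rk≤∣∣ (rank1 X) ⟩
    ∣ X ─ X ∣            ≡⟨ cong ∣_∣ (Empty-unique λ { (y , y∈) →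
                              let (a , b) = x∈p─q⁻ X X y∈ in b a }) ⟩
    ∣ ⊥ {n} ∣            ≡⟨ ∣⊥∣≡0 n ⟩
    0                    <⟨ s≤s z≤n ⟩
    1                    ≡⟨ rank≡1 ⟨
    rank (rank1 X)       ∎)
    (λ _ → spanning)
    where open ≤-Reasoning

  cocircuit-rank1-unique : IsCocircuit (rank1 X) C → C ≡ X
  cocircuit-rank1-unique cC = ⊆-antisym (proj₁ cC) (spanning (cocircuit-rk (rank1 X) cC))

-- Minimal degeneracy with c = k - 1: sparsity and the size bound

module Degenerate {n c} {M : Matroid n} (1≤c : 1 ≤ c)
                  (deg : MinimallyDegenerate (suc c) M) where
  open MinimallyDegenerate deg

  cogirth≤ : IsCocircuit M C → suc c ≤ ∣ C ∣
  cogirth≤ = proj₂ cogirth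

  non-spanning⇒large : X ⊆ E M → rk M (E M ─ X) < rank M → suc c ≤ ∣ X ∣
  non-spanning⇒large X⊆E r< =
    let (C , cC , C⊆X) = cocircuit⊆ M X⊆E r< in ≤-trans (cogirth≤ cC) (p⊆q⇒∣p∣≤∣q∣ C⊆X)

  indep-⁅⁆ : x ∈ E M → Indep M ⁅ x ⁆
  indep-⁅⁆ {x} x∈E with indep? M ⁅ x ⁆
  ... | yes i = i
  ... | no ¬i = contradiction (x∈E , ¬i) (loopless x)

  -- The condition on restrictions, rewritten with the rank of `M` so that peeling needs no chain of
  -- restricted matroids. The last clause feeds `minimal-absorbs-parallel`.
  small-cocircuit : X ⊂ E M → Nonempty X →
    ∃[ C ] C ⊆ X × ∣ C ∣ ≤ c × rk M (X ─ C) < rk M X ×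
           (∀ {D} → D ⊂ C → rk M X ≤ rk M (X ─ D))
  small-cocircuit {X} X⊂E ne =
    let (g , ((C , cC , ∣C∣) , _) , g≤) = restrictions X⊂E ne
        N = restrict M (proj₁ X⊂E)
    in C , proj₁ cC , ≤-trans (≤-reflexive ∣C∣) g≤ ,
       ≤-trans (s≤s (rk≤rk-restrict M (proj₁ X⊂E) (p─q⊆p X C))) (cocircuit-rk N cC) ,
       (λ D⊂C → ≤-trans (coindep⇒rk N (proj₂ (proj₂ cC) D⊂C))
                        (rk-restrict≤ M (proj₁ X⊂E)))

  sparse : X ⊂ E M → ∣ X ∣ ≤ c * rk M X
  sparse X⊂E = go _ ≤-refl X⊂E
    where
    go : ∀ m {X} → rk M X ≤ m → X ⊂ E M → ∣ X ∣ ≤ c * rk M X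
    go m {X} rk≤ X⊂E with nonempty? X
    -- Peeling may use up the whole set, and the empty set has no cocircuit to peel.
    ... | no empty = ≤-trans (≤-reflexive (trans (cong ∣_∣ (Empty-unique empty)) (∣⊥∣≡0 n))) z≤n
    ... | yes ne with small-cocircuit X⊂E ne
    go zero {X} rk≤ X⊂E | yes ne | C , _ , _ , r< , _ = contradiction (≤-trans r< rk≤) λ ()
    go (suc m) {X} rk≤ X⊂E | yes ne | C , C⊆X , ∣C∣≤c , r< , _ = begin
      ∣ X ∣                      ≡⟨ ∣p─q∣+∣q∣≡∣p∣ C⊆X ⟨
      ∣ X ─ C ∣ + ∣ C ∣          ≤⟨ +-mono-≤ (go m (s≤s⁻¹ (≤-trans r< rk≤))
                                                  (⊆-⊂-trans (p─q⊆p X C) X⊂E)) ∣C∣≤c ⟩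
      c * rk M (X ─ C) + c       ≡⟨ +-comm _ c ⟩
      c + c * rk M (X ─ C)       ≡⟨ *-suc c _ ⟨
      c * suc (rk M (X ─ C))     ≤⟨ *-monoʳ-≤ c r< ⟩
      c * rk M X                 ∎
      where open ≤-Reasoning

  size-bound : ∣ E M ∣ ≤ c * rank M + 1
  size-bound = let (e , e∈E) = nonempty in begin
    ∣ E M ∣                ≡⟨ ∣p-x∣ e∈E ⟨
    suc ∣ E M - e ∣        ≤⟨ s≤s (sparse (x∈p⇒p-x⊂p e∈E)) ⟩
    suc (c * rk M (E M - e)) ≤⟨ s≤s (*-monoʳ-≤ c (rk≤rank M)) ⟩
    suc (c * rank M)       ≡⟨ +-comm 1 _ ⟩
    c * rank M + 1         ∎
    where open ≤-Reasoning

  private instance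
    c-nonZero : NonZero c
    c-nonZero = >-nonZero 1≤c

  -- Tightness survives peeling. At most `c` elements go, and if the rank fell by more than one,
  -- `sparse` for the remainder would leave `X` too few elements. So the rank falls by exactly one
  -- and the remainder is tight again, down to rank 1.
  tight⇒parallel-class : ∀ m → X ⊂ E M → rk M X ≡ suc m → c * rk M X ≤ ∣ X ∣ →
                         ∃[ T ] T ⊆ E M × rk M T ≡ 1 × ∣ T ∣ ≡ c
  tight⇒parallel-class {X} zero X⊂E eq tight = X , proj₁ X⊂E , eq , ≤-antisym
    (≤-trans (sparse X⊂E) (≤-reflexive c*rk))
    (≤-trans (≤-reflexive (sym c*rk)) tight)
    where c*rk = trans (cong (c *_) eq) (*-identityʳ c)
  tight⇒parallel-class {X} (suc m) X⊂E eq tight =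
    let (C , C⊆X , ∣C∣≤c , r< , _) = small-cocircuit X⊂E X-nonempty
        open ≤-Reasoning
        Y = X ─ C
        Y⊂E = ⊆-⊂-trans (p─q⊆p X C) X⊂E
        rkY≤ : rk M Y ≤ suc m
        rkY≤ = s≤s⁻¹ (≤-trans r< (≤-reflexive eq))
        X≤Y+c : ∣ X ∣ ≤ c + ∣ Y ∣
        X≤Y+c = begin
          ∣ X ∣         ≡⟨ ∣p─q∣+∣q∣≡∣p∣ C⊆X ⟨
          ∣ Y ∣ + ∣ C ∣ ≤⟨ +-monoʳ-≤ ∣ Y ∣ ∣C∣≤c ⟩
          ∣ Y ∣ + c     ≡⟨ +-comm _ c ⟩
          c + ∣ Y ∣     ∎
        rkY≥ : suc m ≤ rk M Y
        rkY≥ = s≤s⁻¹ (*-cancelˡ-≤ c (begin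
          c * suc (suc m)   ≡⟨ cong (c *_) eq ⟨
          c * rk M X        ≤⟨ tight ⟩
          ∣ X ∣             ≤⟨ X≤Y+c ⟩
          c + ∣ Y ∣         ≤⟨ +-monoʳ-≤ c (sparse Y⊂E) ⟩
          c + c * rk M Y    ≡⟨ *-suc c _ ⟨
          c * suc (rk M Y)  ∎))
        rkY = ≤-antisym rkY≤ rkY≥
    in tight⇒parallel-class m Y⊂E rkY (+-cancelˡ-≤ c _ _ (begin
      c + c * rk M Y      ≡⟨ *-suc c _ ⟨
      c * suc (rk M Y)    ≤⟨ *-monoʳ-≤ c (≤-trans (s≤s rkY≤) (≤-reflexive (sym eq))) ⟩
      c * rk M X          ≤⟨ tight ⟩
      ∣ X ∣               ≤⟨ X≤Y+c ⟩
      c + ∣ Y ∣           ∎))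
    where
    X-nonempty : Nonempty X
    X-nonempty with nonempty? X
    ... | yes ne = ne
    ... | no empty = contradiction (subst (_≤ 0) eq
      (≤-trans (rk≤∣∣ M) (≤-reflexive (trans (cong ∣_∣ (Empty-unique empty)) (∣⊥∣≡0 n))))) λ ()

  -- The equality case: peeling off one parallel class

  module Extremal {r} (rank≡ : rank M ≡ suc r) (size≡ : ∣ E M ∣ ≡ c * rank M + 1) where

    parallel-class : ∃[ T ] T ⊆ E M × rk M T ≡ 1 × ∣ T ∣ ≡ c
    parallel-class =
      let (e , e∈E) = nonempty
          X⊂E = x∈p⇒p-x⊂p e∈E
          ∣X∣ : ∣ E M - e ∣ ≡ c * rank M
          ∣X∣ = suc-injective (trans (∣p-x∣ e∈E) (trans size≡ (+-comm _ 1)))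
          -- The set has exactly `c * rank M` elements, so `sparse` forbids a smaller rank.
          rkX : rk M (E M - e) ≡ rank M
          rkX = ≤-antisym (rk≤rank M) (*-cancelˡ-≤ c (≤-trans (≤-reflexive (sym ∣X∣)) (sparse X⊂E)))
      in tight⇒parallel-class r X⊂E (trans rkX rank≡)
           (≤-reflexive (trans (cong (c *_) rkX) (sym ∣X∣)))

    small⇒proper : X ⊆ E M → ∣ X ∣ ≤ c → X ⊂ E M
    small⇒proper {X} X⊆E ∣X∣≤c = X⊆E , larger⇒∃∉ X (E M) (begin-strict
      ∣ X ∣            ≤⟨ ∣X∣≤c ⟩
      c                ≡⟨ *-identityʳ c ⟨
      c * 1            ≤⟨ *-monoʳ-≤ c (s≤s z≤n) ⟩
      c * suc r        ≡⟨ cong (c *_) rank≡ ⟨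
      c * rank M       <⟨ n<1+n _ ⟩
      suc (c * rank M) ≡⟨ +-comm 1 _ ⟩
      c * rank M + 1   ≡⟨ size≡ ⟨
      ∣ E M ∣          ∎)
      where open ≤-Reasoning

    tight-cocircuit : x ∈ E M → ∃[ C ] IsCocircuit M C × x ∈ C × ∣ C ∣ ≡ suc c
    tight-cocircuit {x} x∈E =
      let (C , C⊆ , ∣C∣≤c , r< , _) = small-cocircuit (x∈p⇒p-x⊂p x∈E) E-x-nonempty
      in cocircuit-through M cogirth≤ x∈E C⊆ ∣C∣≤c r<
      where
      E-x-nonempty : Nonempty (E M - x)
      E-x-nonempty =
        let (_ , y , y∈E , y∉x) = small⇒proper (x∈p⇒⁅x⁆⊆p x∈E)
                                    (≤-trans (≤-reflexive (∣⁅x⁆∣≡1 x)) 1≤c)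
        in y , x∈p∧x∉q⇒x∈p─q y∈E y∉x

    module Peel {T t} (T⊆E : T ⊆ E M) (rkT : rk M T ≡ 1) (∣T∣ : ∣ T ∣ ≡ c) (t∈T : t ∈ T)
                (1≤r : 1 ≤ r) where

      open Contraction M T⊆E (≤-reflexive rkT) t∈T (indep-⁅⁆ (T⊆E t∈T)) public

      rank-N : rank N ≡ r
      rank-N = suc-injective (trans rank-contract rank≡)

      size-N : ∣ E N ∣ ≡ c * rank N + 1
      size-N = +-cancelʳ-≡ c _ _ (begin
        ∣ E N ∣ + c          ≡⟨ cong (∣ E N ∣ +_) ∣T∣ ⟨
        ∣ E N ∣ + ∣ T ∣      ≡⟨ ∣p─q∣+∣q∣≡∣p∣ T⊆E ⟩
        ∣ E M ∣              ≡⟨ size≡ ⟩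
        c * rank M + 1       ≡⟨ cong (λ x → c * x + 1) rank-contract ⟨
        c * suc (rank N) + 1 ≡⟨ cong (_+ 1) (trans (*-suc c (rank N)) (+-comm c _)) ⟩
        c * rank N + c + 1   ≡⟨ +-assoc _ c 1 ⟩
        c * rank N + (c + 1) ≡⟨ cong (c * rank N +_) (+-comm c 1) ⟩
        c * rank N + (1 + c) ≡⟨ +-assoc _ 1 c ⟨
        c * rank N + 1 + c   ∎)
        where open ≡-Reasoning

      -- Two elements leave room for both uses below: `T` with one more element is still proper in
      -- `M`, and deleting an element of `E N` leaves a non-empty set.
      2≤∣N∣ : 2 ≤ ∣ E N ∣
      2≤∣N∣ = begin
        2              ≤⟨ s≤s (*-mono-≤ 1≤c (≤-trans 1≤r (≤-reflexive (sym rank-N)))) ⟩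
        suc (c * rank N) ≡⟨ +-comm 1 _ ⟩
        c * rank N + 1 ≡⟨ size-N ⟨
        ∣ E N ∣        ∎
        where open ≤-Reasoning

      N⊆M : E N ⊆ E M
      N⊆M = p─q⊆p (E M) T

      N-avoids-T : x ∈ E N → x ∉ T
      N-avoids-T x∈ = proj₂ (x∈p─q⁻ (E M) T x∈)

      -- A loop `e` of the contraction would be parallel to `t`, making `T ∪ ⁅ e ⁆` a proper subset
      -- of rank 1 with `suc c` elements, which `sparse` excludes.
      N-loopless : Loopless N
      N-loopless e (e∈N , ¬i) = <⇒≱ (begin-strict
        c * rk M W  ≤⟨ *-monoʳ-≤ c rkW ⟩
        c * 1       ≡⟨ *-identityʳ c ⟩
        c           <⟨ n<1+n c ⟩
        suc c       ≡⟨ ∣W∣ ⟨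
        ∣ W ∣       ∎) (sparse (W⊆E , larger⇒∃∉ W (E M) ∣W∣<∣E∣))
        where
        open ≤-Reasoning
        W = T ∪ ⁅ e ⁆
        W⊆E : W ⊆ E M
        W⊆E = ∪-least T⊆E (x∈p⇒⁅x⁆⊆p (N⊆M e∈N))
        ∣W∣ : ∣ W ∣ ≡ suc c
        ∣W∣ = trans (∣p∪⁅x⁆∣≡1+∣p∣ (N-avoids-T e∈N)) (cong suc ∣T∣)
        ∣W∣<∣E∣ : ∣ W ∣ < ∣ E M ∣
        ∣W∣<∣E∣ = begin-strict
          ∣ W ∣           ≡⟨ trans ∣W∣ (cong suc (sym ∣T∣)) ⟩
          suc ∣ T ∣       <⟨ +-monoˡ-≤ ∣ T ∣ 2≤∣N∣ ⟩
          ∣ E N ∣ + ∣ T ∣ ≡⟨ ∣p─q∣+∣q∣≡∣p∣ T⊆E ⟩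
          ∣ E M ∣         ∎
        P = ⁅ e ⁆ ∪ ⁅ t ⁆
        ∣P∣ : ∣ P ∣ ≡ 2
        ∣P∣ = trans (∣p∪⁅x⁆∣≡1+∣p∣ (λ t∈e → N-avoids-T (x∈p⇒⁅x⁆⊆p e∈N t∈e) t∈T))
                    (cong suc (∣⁅x⁆∣≡1 e))
        rkP : rk M P ≤ 1
        rkP = rk-least M (λ {I} I⊆P i → s≤s⁻¹ (≰⇒> (λ 2≤I →
          ¬i ( x∈p⇒⁅x⁆⊆p e∈N
             , indep-⊆ M (⊆-by-size I⊆P (≤-trans (≤-reflexive ∣P∣) 2≤I)) i))))
        rkW : rk M W ≤ 1
        rkW = begin
          rk M W       ≤⟨ rk-mono M (∪-least (q⊆p∪q P T) (p⊆p∪q T ∘ p⊆p∪q ⁅ t ⁆)) ⟩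
          rk M (P ∪ T) ≤⟨ rk-∪-parallel M (≤-reflexive rkT) t∈T (indep-⁅⁆ (T⊆E t∈T))
                            (q⊆p∪q ⁅ e ⁆ ⁅ t ⁆ (x∈⁅x⁆ t)) ⟩
          rk M P       ≤⟨ rkP ⟩
          1            ∎

      -- The small set is peeled off `X ∪ T` because the contraction sees the rank of that union; it
      -- is proper in `M` since `X` is proper in `E N`. If the peeled set misses `T` it serves
      -- unchanged; otherwise it equals `T` and a fresh one is taken from `X`.
      N-small-cocircuit : X ⊂ E N → Nonempty X → ∃[ C ] C ⊆ X × ∣ C ∣ ≤ c × rk N (X ─ C) < rk N X
      N-small-cocircuit {X} (X⊆N , w , w∈N , w∉X) X-ne = split (nonempty? (K ∩ T))
        where
        open ≤-Reasoning
        X∪T = X ∪ T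
        X∪T⊂E : X∪T ⊂ E M
        X∪T⊂E = ∪-least (λ x∈ → N⊆M (X⊆N x∈)) T⊆E , w , N⊆M w∈N ,
              [ w∉X , N-avoids-T w∈N ]′ ∘ x∈p∪q⁻ X T
        X⊂E : X ⊂ E M
        X⊂E = (λ x∈ → N⊆M (X⊆N x∈)) , w , N⊆M w∈N , w∉X
        small = small-cocircuit X∪T⊂E (t , q⊆p∪q X T t∈T)
        K = proj₁ small
        K⊆X∪T : K ⊆ X∪T
        K⊆X∪T = proj₁ (proj₂ small)
        ∣K∣≤c = proj₁ (proj₂ (proj₂ small))
        r< = proj₁ (proj₂ (proj₂ (proj₂ small)))
        split : Dec (Nonempty (K ∩ T)) → ∃[ C ] C ⊆ X × ∣ C ∣ ≤ c × rk N (X ─ C) < rk N X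
        split (no disjoint) = K , K⊆X , ∣K∣≤c , s≤s⁻¹ (begin-strict
          suc (rk N (X ─ K))  ≡⟨ rk-contract (λ x∈ → X⊆N (p─q⊆p X K x∈)) ⟩
          rk M ((X ─ K) ∪ T)  ≤⟨ rk-mono M (∪-least (─-monoˡ (p⊆p∪q T))
                                   (λ x∈T → x∈p∧x∉q⇒x∈p─q (q⊆p∪q X T x∈T)
                                     (λ x∈K → disjoint (_ , x∈p∩q⁺ (x∈K , x∈T))))) ⟩
          rk M (X∪T ─ K)      <⟨ r< ⟩
          rk M X∪T            ≡⟨ rk-contract X⊆N ⟨
          suc (rk N X)        ∎)
          where
          K⊆X : K ⊆ X
          K⊆X x∈K = [ id , (λ x∈T → contradiction (_ , x∈p∩q⁺ (x∈K , x∈T)) disjoint) ]′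
                      (x∈p∪q⁻ X T (K⊆X∪T x∈K))
        -- Here K = T splits off as a direct summand, so that M / T agrees with M on X.
        split (yes (z , z∈)) =
          let (z∈K , z∈T) = x∈p∩q⁻ K T z∈
              T⊆K = minimal-absorbs-parallel M r< (proj₂ (proj₂ (proj₂ (proj₂ small))))
                      (q⊆p∪q X T) (≤-reflexive rkT) (λ u∈T → indep-⁅⁆ (T⊆E u∈T)) z∈K z∈T
              K⊆T = ⊆-by-size T⊆K (≤-trans ∣K∣≤c (≤-reflexive (sym ∣T∣)))
              (D , D⊆X , ∣D∣≤c , D< , _) = small-cocircuit X⊂E X-ne
          in D , D⊆X , ∣D∣≤c , (begin-strict
            rk N (X ─ D)         <⟨ n<1+n _ ⟩
            suc (rk N (X ─ D))   ≡⟨ rk-contract (λ x∈ → X⊆N (p─q⊆p X D x∈)) ⟩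
            rk M ((X ─ D) ∪ T)   ≤⟨ rk-subadditive M (X ─ D) T ⟩
            rk M (X ─ D) + rk M T ≡⟨ trans (cong (rk M (X ─ D) +_) rkT) (+-comm _ 1) ⟩
            suc (rk M (X ─ D))   ≤⟨ D< ⟩
            rk M X               ≤⟨ rk-mono M (λ x∈X → x∈p∧x∉q⇒x∈p─q (p⊆p∪q T x∈X)
                                      (λ x∈K → N-avoids-T (X⊆N x∈X) (K⊆T x∈K))) ⟩
            rk M (X∪T ─ K)       ≤⟨ s≤s⁻¹ (≤-trans r< (≤-reflexive (sym (rk-contract X⊆N)))) ⟩
            rk N X               ∎)

      N-cogirth≤ : IsCocircuit N C → suc c ≤ ∣ C ∣
      N-cogirth≤ cC = cogirth≤ (cocircuit⁺ cC)

      N-degenerate : MinimallyDegenerate (suc c) N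
      N-degenerate = record
        { nonempty     = N-nonempty
        ; loopless     = N-loopless
        ; cogirth      =
            -- The value is attained: a small set peeled off `E N - e`, completed by `e`, is a
            -- cocircuit of size `suc c`.
            (let (e , e∈N) = N-nonempty
                 (C , C⊆ , ∣C∣≤c , r<) = N-small-cocircuit (x∈p⇒p-x⊂p e∈N)
                   (0<∣p∣⇒Nonempty (s≤s⁻¹ (≤-trans 2≤∣N∣ (≤-reflexive (sym (∣p-x∣ e∈N))))))
                 (D , cD , _ , ∣D∣) = cocircuit-through N N-cogirth≤ e∈N C⊆ ∣C∣≤c r<
             in D , cD , ∣D∣) ,
            N-cogirth≤
        ; restrictions = λ X⊂N X-ne →
            let (C , C⊆ , ∣C∣≤c , r<) = N-small-cocircuit X⊂N X-ne
                (g , cog , g≤) = cogirth⊆ (restrict N (proj₁ X⊂N)) C⊆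
                  (≤-trans (s≤s (rk-restrict≤ N (proj₁ X⊂N))) r<)
            in g , cog , ≤-trans g≤ ∣C∣≤c
        }
        where
        N-nonempty : Nonempty (E N)
        N-nonempty = 0<∣p∣⇒Nonempty (<⇒≤ 2≤∣N∣)

      -- A cocircuit of `M` contains `T` or avoids it, so later case distinctions need only test the
      -- single element `t`.
      cocircuit-absorbs-T : IsCocircuit M C → x ∈ C → x ∈ T → T ⊆ C
      cocircuit-absorbs-T cC = minimal-absorbs-parallel M
        (≤-trans (cocircuit-rk M cC) (≤-reflexive (rank≡rk M)))
        (λ D⊂C → ≤-trans (≤-reflexive (sym (rank≡rk M))) (coindep⇒rk M (proj₂ (proj₂ cC) D⊂C)))
        T⊆E (≤-reflexive rkT) (λ u∈T → indep-⁅⁆ (T⊆E u∈T))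

      disjoint⇒⊆N : IsCocircuit M C → t ∉ C → C ⊆ E N
      disjoint⇒⊆N cC t∉C x∈C = x∈p∧x∉q⇒x∈p─q (proj₁ cC x∈C)
        (λ x∈T → t∉C (cocircuit-absorbs-T cC x∈C x∈T t∈T))

      leaf-cocircuit : ∃[ p ] p ∉ T × IsCocircuit M (T ∪ ⁅ p ⁆)
      leaf-cocircuit =
        let (Q , cQ , t∈Q , ∣Q∣) = tight-cocircuit (T⊆E t∈T)
            T⊆Q = cocircuit-absorbs-T cQ t∈Q t∈T
            (p , p∈Q , p∉T) = larger⇒∃∉ T Q
              (≤-reflexive (trans (cong suc ∣T∣) (sym ∣Q∣)))
            T∪p⊆Q = ∪-least T⊆Q (x∈p⇒⁅x⁆⊆p p∈Q)
            Q⊆T∪p = ⊆-by-size T∪p⊆Q (≤-reflexive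
              (trans ∣Q∣ (sym (trans (∣p∪⁅x⁆∣≡1+∣p∣ p∉T) (cong suc ∣T∣)))))
        in p , p∉T , subst (IsCocircuit M) (⊆-antisym Q⊆T∪p T∪p⊆Q) cQ

      module Leaf {p} (p∉T : p ∉ T) (cQ : IsCocircuit M (T ∪ ⁅ p ⁆)) where

        Q : Subset n
        Q = T ∪ ⁅ p ⁆

        t∈Q : t ∈ Q
        t∈Q = p⊆p∪q ⁅ p ⁆ t∈T

        p∈Q : p ∈ Q
        p∈Q = q⊆p∪q T ⁅ p ⁆ (x∈⁅x⁆ p)

        p∈N : p ∈ E N
        p∈N = x∈p∧x∉q⇒x∈p─q (proj₁ cQ p∈Q) p∉T

        Q-p⊆T : x ∈ Q → x ∉ ⁅ p ⁆ → x ∈ T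
        Q-p⊆T x∈Q x∉p = [ id , (λ x∈p → contradiction x∈p x∉p) ]′ (x∈p∪q⁻ T ⁅ p ⁆ x∈Q)

        -- Eliminate `t` between `C` and `Q`. A resulting cocircuit `K` avoids `T`, and it contains
        -- `p`, since otherwise it would be a proper subset of `C`. Eliminating `p` between `K` and
        -- `Q` leads back into `C`, so minimality of `C` shows that `K` omits nothing of `C ─ T`.
        T⊆C⇒swap : IsCocircuit M C → T ⊆ C → p ∉ C → IsCocircuit M ((C ─ T) ∪ ⁅ p ⁆)
        T⊆C⇒swap {C} cC T⊆C p∉C =
          let (K , cK , K⊆) = cocircuit⊆ M {(C ∪ Q) - t}
                (λ x∈ → ∪-least (proj₁ cC) (proj₁ cQ) (p─q⊆p (C ∪ Q) ⁅ t ⁆ x∈))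
                (cocircuit-elimination M cC cQ p∈Q p∉C (T⊆C t∈T) t∈Q)
          in subst (IsCocircuit M) (eliminated cK K⊆) cK
          where
          eliminated : ∀ {K} → IsCocircuit M K → K ⊆ (C ∪ Q) - t → K ≡ (C ─ T) ∪ ⁅ p ⁆
          eliminated {K} cK K⊆ = ⊆-antisym K⊆C′ C′⊆K
            where
            t∉K : t ∉ K
            t∉K t∈K = proj₂ (x∈p─q⁻ (C ∪ Q) ⁅ t ⁆ (K⊆ t∈K)) (x∈⁅x⁆ t)
            K⊆C′ : K ⊆ (C ─ T) ∪ ⁅ p ⁆
            K⊆C′ {x} x∈K with x ∈? ⁅ p ⁆ | x∈p∪q⁻ C Q (p─q⊆p (C ∪ Q) ⁅ t ⁆ (K⊆ x∈K))
            ... | yes x∈p | _ = q⊆p∪q (C ─ T) ⁅ p ⁆ x∈p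
            ... | no x∉p | inj₁ x∈C = p⊆p∪q ⁅ p ⁆ (x∈p∧x∉q⇒x∈p─q x∈C
              (N-avoids-T (disjoint⇒⊆N cK t∉K x∈K)))
            ... | no x∉p | inj₂ x∈Q =
              contradiction (Q-p⊆T x∈Q x∉p) (N-avoids-T (disjoint⇒⊆N cK t∉K x∈K))
            K-p⊆C : x ∈ K → x ∉ ⁅ p ⁆ → x ∈ C
            K-p⊆C x∈K x∉p = [ p─q⊆p C T , (λ x∈p → contradiction x∈p x∉p) ]′
              (x∈p∪q⁻ (C ─ T) ⁅ p ⁆ (K⊆C′ x∈K))
            p∈K : p ∈ K
            p∈K with p ∈? K
            ... | yes p∈K = p∈K
            ... | no p∉K = contradiction
              (cocircuit-min M {X = K} cC (λ x∈K → K-p⊆C x∈K (λ x∈p → p∉K (subst (_∈ K) (x∈⁅y⁆⇒x≡y p x∈p) x∈K)))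
                (cocircuit-rk M cK) (T⊆C t∈T)) t∉K
            C⊆K∪Q : C ⊆ (K ∪ Q) - p
            C⊆K∪Q = cocircuit-min M {X = (K ∪ Q) - p} cC
              (λ x∈ → let (x∈KQ , x∉p) = x∈p─q⁻ (K ∪ Q) ⁅ p ⁆ x∈ in
                [ (λ x∈K → K-p⊆C x∈K x∉p) , (λ x∈Q → T⊆C (Q-p⊆T x∈Q x∉p)) ]′ (x∈p∪q⁻ K Q x∈KQ))
              (cocircuit-elimination M cK cQ t∈Q t∉K p∈K p∈Q)
            C′⊆K : (C ─ T) ∪ ⁅ p ⁆ ⊆ K
            C′⊆K = ∪-least
              (λ x∈ → let (x∈C , x∉T) = x∈p─q⁻ C T x∈
                          (x∈KQ , x∉p) = x∈p─q⁻ (K ∪ Q) ⁅ p ⁆ (C⊆K∪Q x∈C)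
                      in [ id , (λ x∈Q → contradiction (Q-p⊆T x∈Q x∉p) x∉T) ]′ (x∈p∪q⁻ K Q x∈KQ))
              (x∈p⇒⁅x⁆⊆p p∈K)

        -- The inverse exchange. A cocircuit `K` obtained by eliminating `p` must contain `t`, and
        -- with it `T`, or it would be a proper subset of `C`. Swapping `K` back gives a cocircuit
        -- inside `C`, hence all of `C`.
        swap⁻ : IsCocircuit M C → p ∈ C → t ∉ C → IsCocircuit M ((Q ∪ C) - p)
        swap⁻ {C} cC p∈C t∉C =
          let (K , cK , K⊆) = cocircuit⊆ M {(Q ∪ C) - p}
                (λ x∈ → ∪-least (proj₁ cQ) (proj₁ cC) (p─q⊆p (Q ∪ C) ⁅ p ⁆ x∈))
                -- Elimination asks for an element of its second cocircuit outside the first. Here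
                -- that is `t`, in `Q` but not in `C`, which fixes the order of the two.
                (subst (λ X → rk M (E M ─ (X - p)) < rank M) (∪-comm C Q)
                  (cocircuit-elimination M cC cQ t∈Q t∉C p∈C p∈Q))
          in subst (IsCocircuit M) (eliminated cK K⊆) cK
          where
          eliminated : ∀ {K} → IsCocircuit M K → K ⊆ (Q ∪ C) - p → K ≡ (Q ∪ C) - p
          eliminated {K} cK K⊆ = ⊆-antisym K⊆ ⊆K
            where
            p∉K : p ∉ K
            p∉K p∈K = proj₂ (x∈p─q⁻ (Q ∪ C) ⁅ p ⁆ (K⊆ p∈K)) (x∈⁅x⁆ p)
            K─T⊆C : x ∈ K → x ∉ T → x ∈ C
            K─T⊆C x∈K x∉T =
              let (x∈QC , x∉p) = x∈p─q⁻ (Q ∪ C) ⁅ p ⁆ (K⊆ x∈K) in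
              [ (λ x∈Q → contradiction (Q-p⊆T x∈Q x∉p) x∉T) , id ]′ (x∈p∪q⁻ Q C x∈QC)
            t∈K : t ∈ K
            t∈K with t ∈? K
            ... | yes t∈K = t∈K
            ... | no t∉K = contradiction
              (cocircuit-min M {X = K} cC (λ x∈K → K─T⊆C x∈K (N-avoids-T (disjoint⇒⊆N cK t∉K x∈K)))
                (cocircuit-rk M cK) p∈C) p∉K
            T⊆K : T ⊆ K
            T⊆K = cocircuit-absorbs-T cK t∈K t∈T
            C⊆K′ : C ⊆ (K ─ T) ∪ ⁅ p ⁆
            C⊆K′ = cocircuit-min M {X = (K ─ T) ∪ ⁅ p ⁆} cC
              (∪-least (λ x∈ → let (a , b) = x∈p─q⁻ K T x∈ in K─T⊆C a b) (x∈p⇒⁅x⁆⊆p p∈C))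
              (cocircuit-rk M (T⊆C⇒swap cK T⊆K p∉K))
            ⊆K : (Q ∪ C) - p ⊆ K
            ⊆K x∈ = let (x∈QC , x∉p) = x∈p─q⁻ (Q ∪ C) ⁅ p ⁆ x∈ in
              [ (λ x∈Q → T⊆K (Q-p⊆T x∈Q x∉p))
              , (λ x∈C → [ p─q⊆p K T , (λ x∈p → contradiction x∈p x∉p) ]′
                           (x∈p∪q⁻ (K ─ T) ⁅ p ⁆ (C⊆K′ x∈C))) ]′ (x∈p∪q⁻ Q C x∈QC)

        series-connection : IsSeriesConnection (rank1 Q) N p M
        series-connection = record
          { meet        = ⊆-antisym
              (λ x∈ → let (x∈Q , x∈N) = x∈p∩q⁻ Q (E N) x∈ in
                [ (λ x∈T → contradiction x∈T (N-avoids-T x∈N)) , id ]′ (x∈p∪q⁻ T ⁅ p ⁆ x∈Q))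
              (x∈p⇒⁅x⁆⊆p (x∈p∩q⁺ (p∈Q , p∈N)))
          ; not-loop₁   = λ (_ , ¬i) → ¬i (x∈p⇒⁅x⁆⊆p p∈Q , ≤-reflexive (∣⁅x⁆∣≡1 p))
          ; not-coloop₁ = λ (_ , in-bases) → p∉T (subst (_∈ T)
              (sym (x∈⁅y⁆⇒x≡y t (in-bases
                ( (x∈p⇒⁅x⁆⊆p t∈Q , ≤-reflexive (∣⁅x⁆∣≡1 t))
                , λ (_ , ∣I∣≤1) t⊆I → ⊆-by-size t⊆I (≤-trans ∣I∣≤1 (≤-reflexive (sym (∣⁅x⁆∣≡1 t))))))))
              t∈T)
          ; not-loop₂   = N-loopless p
          ; not-coloop₂ = λ (_ , in-bases) →
              -- If every basis needed `p`, then `⁅ p ⁆` would have a non-spanning complement, yet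
              -- such sets have at least `suc c`, so at least two, elements.
              let (B , basis , p∈) = rk⇒coindep N (x∈p⇒⁅x⁆⊆p p∈N) (≮⇒≥ λ r< →
                    <⇒≱ (s≤s 1≤c) (≤-trans (non-spanning⇒large
                      (λ x∈ → N⊆M (x∈p⇒⁅x⁆⊆p p∈N x∈)) (non-spanning⁺ (x∈p⇒⁅x⁆⊆p p∈N) r<))
                      (≤-reflexive (∣⁅x⁆∣≡1 p))))
              in proj₂ (x∈p─q⁻ (E N) B (p∈ (x∈⁅x⁆ p))) (in-bases basis)
          ; ground      = ⊆-antisym ground⊆ (∪-least (proj₁ cQ) N⊆M)
          ; cocircuits  = λ C → mk⇔ (to C) from
          }
          where
          ground⊆ : E M ⊆ Q ∪ E N
          ground⊆ {x} x∈E with x ∈? T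
          ... | yes x∈T = p⊆p∪q (E N) (p⊆p∪q ⁅ p ⁆ x∈T)
          ... | no x∉T = q⊆p∪q Q (E N) (x∈p∧x∉q⇒x∈p─q x∈E x∉T)
          Split : Subset n → Set
          Split C = IsCocircuit (rank1 Q) C ⊎ IsCocircuit N C
            ⊎ (∃[ C₁ ] ∃[ C₂ ] IsCocircuit (rank1 Q) C₁ × p ∈ C₁ × IsCocircuit N C₂ × p ∈ C₂
                             × C ≡ (C₁ ∪ C₂) - p)
          to : ∀ C → IsCocircuit M C → Split C
          -- Without `t` the cocircuit lies in the contraction. With `t` and `p` it contains `Q`,
          -- hence equals it. With `t` alone it is of the mixed kind, its second part being the
          -- swapped cocircuit.
          to C cC with t ∈? C | p ∈? C
          ... | no t∉C | _ = inj₂ (inj₁ (cocircuit⁻ (disjoint⇒⊆N cC t∉C) cC))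
          ... | yes t∈C | yes p∈C = inj₁ (subst (IsCocircuit (rank1 Q)) (⊆-antisym Q⊆C C⊆Q)
                                              (cocircuit-rank1 p∈Q))
            where
            Q⊆C : Q ⊆ C
            Q⊆C = ∪-least (cocircuit-absorbs-T cC t∈C t∈T) (x∈p⇒⁅x⁆⊆p p∈C)
            C⊆Q : C ⊆ Q
            C⊆Q = cocircuit-min M cC Q⊆C (cocircuit-rk M cQ)
          ... | yes t∈C | no p∉C = inj₂ (inj₂ (Q , C′ , cocircuit-rank1 p∈Q , p∈Q ,
              cocircuit⁻ C′⊆N (T⊆C⇒swap cC T⊆C p∉C) , q⊆p∪q (C ─ T) ⁅ p ⁆ (x∈⁅x⁆ p) ,
              ⊆-antisym C⊆ ⊆C))
            where
            T⊆C = cocircuit-absorbs-T cC t∈C t∈T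
            C′ = (C ─ T) ∪ ⁅ p ⁆
            C′⊆N : C′ ⊆ E N
            C′⊆N = ∪-least (─-monoˡ (proj₁ cC)) (x∈p⇒⁅x⁆⊆p p∈N)
            C⊆ : C ⊆ (Q ∪ C′) - p
            C⊆ {x} x∈C with x ∈? T
            ... | yes x∈T = x∈p∧x∉q⇒x∈p─q (p⊆p∪q C′ (p⊆p∪q ⁅ p ⁆ x∈T))
              (λ x∈p → p∉C (subst (_∈ C) (x∈⁅y⁆⇒x≡y p x∈p) x∈C))
            ... | no x∉T = x∈p∧x∉q⇒x∈p─q (q⊆p∪q Q C′ (p⊆p∪q ⁅ p ⁆ (x∈p∧x∉q⇒x∈p─q x∈C x∉T)))
              (λ x∈p → p∉C (subst (_∈ C) (x∈⁅y⁆⇒x≡y p x∈p) x∈C))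
            ⊆C : (Q ∪ C′) - p ⊆ C
            ⊆C x∈ = let (x∈QC′ , x∉p) = x∈p─q⁻ (Q ∪ C′) ⁅ p ⁆ x∈ in
              [ (λ x∈Q → T⊆C (Q-p⊆T x∈Q x∉p))
              , (λ x∈C′ → [ p─q⊆p C T , (λ x∈p → contradiction x∈p x∉p) ]′
                            (x∈p∪q⁻ (C ─ T) ⁅ p ⁆ x∈C′)) ]′ (x∈p∪q⁻ Q C′ x∈QC′)
          from : Split C → IsCocircuit M C
          from (inj₁ cC) = subst (IsCocircuit M) (sym (cocircuit-rank1-unique p∈Q cC)) cQ
          from (inj₂ (inj₁ cC)) = cocircuit⁺ cC
          from (inj₂ (inj₂ (C₁ , C₂ , cC₁ , p∈C₁ , cC₂ , p∈C₂ , eq)))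
            rewrite eq | cocircuit-rank1-unique p∈Q cC₁ =
            swap⁻ (cocircuit⁺ cC₂) p∈C₂ (λ t∈C₂ → N-avoids-T (proj₁ cC₂ t∈C₂) t∈T)

-- Bijections of ground sets: size and rank as invariants

enum : (p : Subset n) → Fin ∣ p ∣ ↔ (∃[ x ] x ∈ p)
enum p = mk↔ₛ′ (to p) (from p) (to∘from p) (from∘to p)
  where
  to : ∀ {n} (p : Subset n) → Fin ∣ p ∣ → ∃[ x ] x ∈ p
  to (true ∷ p) zero = zero , here
  to (true ∷ p) (suc i) = let (x , x∈) = to p i in suc x , there x∈
  to (false ∷ p) i = let (x , x∈) = to p i in suc x , there x∈
  from : ∀ {n} (p : Subset n) → ∃[ x ] x ∈ p → Fin ∣ p ∣
  from (true ∷ p) (zero , _) = zero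
  from (true ∷ p) (suc x , there x∈) = suc (from p (x , x∈))
  from (false ∷ p) (suc x , there x∈) = from p (x , x∈)
  to∘from : ∀ {n} (p : Subset n) x → to p (from p x) ≡ x
  to∘from (true ∷ p) (zero , here) = refl
  to∘from (true ∷ p) (suc x , there x∈) rewrite to∘from p (x , x∈) = refl
  to∘from (false ∷ p) (suc x , there x∈) rewrite to∘from p (x , x∈) = refl
  from∘to : ∀ {n} (p : Subset n) i → from p (to p i) ≡ i
  from∘to (true ∷ p) zero = refl
  from∘to (true ∷ p) (suc i) = cong suc (from∘to p i)
  from∘to (false ∷ p) i = from∘to p i

equinumerous⇒↔ : {p : Subset m} {q : Subset n} → ∣ p ∣ ≡ ∣ q ∣ → (∃[ x ] x ∈ p) ↔ (∃[ x ] x ∈ q)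
equinumerous⇒↔ {p = p} {q} eq =
  enum q ↔-∘ subst (λ k → (∃[ x ] x ∈ p) ↔ Fin k) eq (↔-sym (enum p))

≡-∃∈ : {u v : ∃[ x ] x ∈ p} → proj₁ u ≡ proj₁ v → u ≡ v
≡-∃∈ {u = x , x∈} {v = .x , x∈′} refl = cong (x ,_) ([]=-irrelevant x∈ x∈′)

injection⇒∣∣≤ : (p : Subset m) (q : Subset n) (f : ∃[ x ] x ∈ p → ∃[ y ] y ∈ q) →
                (∀ {u v} → proj₁ (f u) ≡ proj₁ (f v) → u ≡ v) → ∣ p ∣ ≤ ∣ q ∣
injection⇒∣∣≤ p q f f-inj =
  injective⇒≤ {f = Inverse.from (enum q) ∘ f ∘ Inverse.to (enum p)} (λ eq →
    Injection.injective (↔⇒↣ (enum p))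
      (f-inj (cong proj₁ (Injection.injective (↔⇒↣ (↔-sym (enum q))) eq))))

comprehension : {P : Fin n → Set} → (∀ x → Dec (P x)) → Subset n
comprehension P? = tabulate (does ∘ P?)

∈-comprehension : {P : Fin n → Set} (P? : ∀ x → Dec (P x)) → x ∈ comprehension P? ⇔ P x
∈-comprehension {x = x} P? = mk⇔
  (λ x∈ → invert (subst (Reflects _) (trans (sym (lookup∘tabulate (does ∘ P?) x)) ([]=⇒lookup x∈))
                        (proof (P? x))))
  (λ px → lookup⇒[]= x _ (trans (lookup∘tabulate (does ∘ P?) x) (dec-true (P? x) px)))

module _ {M : Matroid m} {N : Matroid n} (M≅N : M ≅ N) where
  open _≅_ M≅N
  open Inverse bij using (to; from; strictlyInverseˡ; strictlyInverseʳ)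

  ≅-sym : N ≅ M
  ≅-sym = record
    { bij    = ↔-sym bij
    ; indep⇔ = λ {I} {J} I⊆N J⊆M image →
        let e = indep⇔ J⊆M I⊆N (λ x → mk⇔
              (λ x∈J → Equivalence.from (image (to x))
                         (subst (λ u → proj₁ u ∈ J) (sym (strictlyInverseʳ x)) x∈J))
              (λ x∈I → subst (λ u → proj₁ u ∈ J) (strictlyInverseʳ x)
                         (Equivalence.to (image (to x)) x∈I)))
        in mk⇔ (Equivalence.from e) (Equivalence.to e)
    }

  IsImage⇒∣∣≤ : {I : Subset m} {J : Subset n} → I ⊆ E M → IsImage I J → ∣ I ∣ ≤ ∣ J ∣
  IsImage⇒∣∣≤ {I} {J} I⊆M image = injection⇒∣∣≤ I J
    (λ (x , x∈I) → proj₁ (to (x , I⊆M x∈I)) , Equivalence.to (image (x , I⊆M x∈I)) x∈I)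
    (λ eq → ≡-∃∈ (cong proj₁ (Injection.injective (↔⇒↣ bij) (≡-∃∈ eq))))

  ≅⇒size≤ : ∣ E M ∣ ≤ ∣ E N ∣
  ≅⇒size≤ = injection⇒∣∣≤ (E M) (E N) to (λ eq → Injection.injective (↔⇒↣ bij) (≡-∃∈ eq))

  ≅⇒rank≤ : rank M ≤ rank N
  ≅⇒rank≤ =
    let (I , I⊆ , i , ∣I∣) = rk-attained M (E M)
        J = comprehension (image? I)
        ∈J : ∀ {y} → y ∈ J ⇔ (∃[ h ] proj₁ (from (y , h)) ∈ I)
        ∈J = ∈-comprehension (image? I)
        image : IsImage I J
        image x = mk⇔
          (λ x∈I → Equivalence.from ∈J (proj₂ (to x) ,
                     subst (λ u → proj₁ u ∈ I) (sym (strictlyInverseʳ x)) x∈I))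
          (λ y∈J → let (h , ∈I) = Equivalence.to ∈J y∈J in
                     subst (λ u → proj₁ u ∈ I) (trans (cong from (≡-∃∈ refl)) (strictlyInverseʳ x)) ∈I)
    in ≤-trans (≤-reflexive (trans (rank≡rk M) (sym ∣I∣))) (≤-trans (IsImage⇒∣∣≤ I⊆ image)
         (∣∣≤rank N (Equivalence.to (indep⇔ I⊆ (λ y∈J → proj₁ (Equivalence.to ∈J y∈J)) image) i)))
    where
    -- The predicate ranges over proofs of `y ∈ E N`. They are unique, so the one found by the
    -- decision procedure settles it.
    image? : ∀ I y → Dec (∃[ h ] proj₁ (from (y , h)) ∈ I)
    image? I y with y ∈? E N
    ... | no y∉ = no (y∉ ∘ proj₁)
    ... | yes h with proj₁ (from (y , h)) ∈? I
    ...   | yes ∈I = yes (h , ∈I)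
    ...   | no ∉I = no (λ (h′ , ∈I) →
              ∉I (subst (λ h → proj₁ (from (y , h)) ∈ I) ([]=-irrelevant h′ h) ∈I))

-- On both sides independence depends on size alone, so any bijection of the ground sets is an
-- isomorphism.
U₁≅ : (M : Matroid n) → ∀ {k} → ∣ E M ∣ ≡ k → (∀ {I} → I ⊆ E M → Indep M I ⇔ ∣ I ∣ ≤ 1) → U 1 k ≅ M
U₁≅ {n} M {k} size uniform₁ = record
  { bij    = β
  ; indep⇔ = λ {I} {J} _ J⊆M image → mk⇔
      (λ ∣I∣≤1 → Equivalence.from (uniform₁ J⊆M) (≤-trans
        (injection⇒∣∣≤ J I
          (λ (y , y∈J) → proj₁ (from (y , J⊆M y∈J)) ,
             Equivalence.from (image (from (y , J⊆M y∈J)))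
               (subst (λ u → proj₁ u ∈ J) (sym (strictlyInverseˡ (y , J⊆M y∈J))) y∈J))
          (λ eq → ≡-∃∈ (cong proj₁ (Injection.injective (↔⇒↣ (↔-sym β)) (≡-∃∈ eq)))))
        ∣I∣≤1))
      (λ j → ≤-trans
        (injection⇒∣∣≤ I J
          (λ (x , x∈I) → proj₁ (to (x , ∈⊤)) , Equivalence.to (image (x , ∈⊤)) x∈I)
          (λ eq → ≡-∃∈ (cong proj₁ (Injection.injective (↔⇒↣ β) (≡-∃∈ eq)))))
        (Equivalence.to (uniform₁ J⊆M) j))
  }
  where
  β : (∃[ x ] x ∈ ⊤ {k}) ↔ (∃[ y ] y ∈ E M)
  β = equinumerous⇒↔ (trans (∣⊤∣≡n k) (sym size))
  open Inverse β using (to; from; strictlyInverseˡ)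

-- Size and rank of a series connection

basis-avoiding : (M : Matroid n) → x ∈ E M → ¬ IsColoop M x → ∃[ B ] IsBasis M B × x ∉ B
-- Not being a coloop is a negated universal statement and yields no basis by itself; deciding
-- whether deleting `x` lowers the rank does.
basis-avoiding {x = x} M x∈E not-coloop with rk M (E M - x) <? rank M
... | no r≮ =
  let (B , basis , x∈) = rk⇒coindep M (x∈p⇒⁅x⁆⊆p x∈E) (≮⇒≥ r≮)
  in B , basis , proj₂ (x∈p─q⁻ (E M) B (x∈ (x∈⁅x⁆ x)))
... | yes r< = contradiction (x∈E , λ {B} → in-bases {B}) not-coloop
  where
  in-bases : ∀ {B} → IsBasis M B → x ∈ B
  in-bases {B} basis with x ∈? B
  ... | yes x∈B = x∈B
  ... | no x∉B = contradiction
    (coindep⇒rk M (B , basis , x∈p⇒⁅x⁆⊆p (x∈p∧x∉q⇒x∈p─q x∈E x∉B))) (<⇒≱ r<)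

-- If `e` in `B` were missing from `I`, the fundamental cocircuit of `e`, which lies in the
-- complement of `B` together with `e`, would be a cocircuit of `S` disjoint from `I`. But `I` spans
-- `S`.
basis-of-part⊆ : {M S : Matroid n} {B I : Subset n} → (∀ {C} → IsCocircuit M C → IsCocircuit S C) →
  IsBasis M B → Indep S I → rank S ≤ ∣ I ∣ → (∀ {x} → x ∈ I → x ∈ E M → x ∈ B) → B ⊆ I
basis-of-part⊆ {M = M} {S} {B} {I} cocircuit basis i rank≤ I∩M⊆B {e} e∈B with e ∈? I
... | yes e∈I = e∈I
... | no e∉I =
  let (C , cC , C⊆) = cocircuit⊆ M {(E M ─ B) ∪ ⁅ e ⁆}
        (∪-least (p─q⊆p (E M) B) (x∈p⇒⁅x⁆⊆p e∈M)) rest-small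
      I∩C=∅ : ∀ {x} → x ∈ I → x ∉ C
      I∩C=∅ x∈I x∈C =
        [ (λ x∈M─B → let (x∈M , x∉B) = x∈p─q⁻ (E M) B x∈M─B in x∉B (I∩M⊆B x∈I x∈M))
        , (λ x∈e → e∉I (subst (_∈ I) (x∈⁅y⁆⇒x≡y e x∈e) x∈I)) ]′ (x∈p∪q⁻ (E M ─ B) ⁅ e ⁆ (C⊆ x∈C))
  in contradiction
       (∣∣≤rk S (λ x∈I → x∈p∧x∉q⇒x∈p─q (indep⊆E S i x∈I) (I∩C=∅ x∈I)) i)
       (<⇒≱ (≤-trans (cocircuit-rk S (cocircuit cC)) rank≤))
  where
  open ≤-Reasoning
  e∈M : e ∈ E M
  e∈M = indep⊆E M (proj₁ basis) e∈B
  ⊆B-e : E M ─ ((E M ─ B) ∪ ⁅ e ⁆) ⊆ B - e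
  ⊆B-e {x} x∈ with x∈p─q⁻ (E M) ((E M ─ B) ∪ ⁅ e ⁆) x∈ | x ∈? B
  ... | x∈M , x∉ | yes x∈B = x∈p∧x∉q⇒x∈p─q x∈B (x∉ ∘ q⊆p∪q (E M ─ B) ⁅ e ⁆)
  ... | x∈M , x∉ | no x∉B = contradiction (p⊆p∪q ⁅ e ⁆ (x∈p∧x∉q⇒x∈p─q x∈M x∉B)) x∉
  rest-small : rk M (E M ─ ((E M ─ B) ∪ ⁅ e ⁆)) < rank M
  rest-small = begin-strict
    rk M (E M ─ ((E M ─ B) ∪ ⁅ e ⁆)) ≤⟨ rk-mono M ⊆B-e ⟩
    rk M (B - e)                     ≤⟨ rk≤∣∣ M ⟩
    ∣ B - e ∣                        <⟨ x∈p⇒∣p-x∣<∣p∣ e∈B ⟩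
    ∣ B ∣                            ≡⟨ basis⇒∣∣≡rank M basis ⟩
    rank M                           ∎

module _ {n} {M₁ M₂ S : Matroid n} {p : Fin n} (sc : IsSeriesConnection M₁ M₂ p S) where
  open IsSeriesConnection sc

  private
    p∈∩ : p ∈ E M₁ × p ∈ E M₂
    p∈∩ = x∈p∩q⁻ (E M₁) (E M₂) (subst (p ∈_) (sym meet) (x∈⁅x⁆ p))

    ∩⇒≡p : x ∈ E M₁ → x ∈ E M₂ → x ≡ p
    ∩⇒≡p x∈M₁ x∈M₂ = x∈⁅y⁆⇒x≡y p (subst (_ ∈_) meet (x∈p∩q⁺ (x∈M₁ , x∈M₂)))

  series-size : suc ∣ E S ∣ ≡ ∣ E M₁ ∣ + ∣ E M₂ ∣
  series-size = begin
    suc ∣ E S ∣                           ≡⟨ +-comm 1 _ ⟩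
    ∣ E S ∣ + 1                           ≡⟨ cong₂ _+_ (cong ∣_∣ ground)
                                               (sym (trans (cong ∣_∣ meet) (∣⁅x⁆∣≡1 p))) ⟩
    ∣ E M₁ ∪ E M₂ ∣ + ∣ E M₁ ∩ E M₂ ∣     ≡⟨ ∣p∪q∣+∣p∩q∣≡∣p∣+∣q∣ (E M₁) (E M₂) ⟩
    ∣ E M₁ ∣ + ∣ E M₂ ∣                   ∎
    where open ≡-Reasoning

  -- The union of bases of M₁ and M₂ avoiding p is a basis of S.
  series-rank : rank S ≡ rank M₁ + rank M₂
  series-rank =
    let (B₁ , b₁ , p∉B₁) = basis-avoiding M₁ (proj₁ p∈∩) not-coloop₁
        (B₂ , b₂ , p∉B₂) = basis-avoiding M₂ (proj₂ p∈∩) not-coloop₂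
    in trans (union-size b₁ b₂ p∉B₁ p∉B₂)
             (cong₂ _+_ (basis⇒∣∣≡rank M₁ b₁) (basis⇒∣∣≡rank M₂ b₂))
    where
    union-size : ∀ {B₁ B₂} → IsBasis M₁ B₁ → IsBasis M₂ B₂ → p ∉ B₁ → p ∉ B₂ →
                 rank S ≡ ∣ B₁ ∣ + ∣ B₂ ∣
    union-size {B₁} {B₂} b₁ b₂ p∉B₁ p∉B₂ = trans (≤-antisym rank≤ rank≥) (∣∪∣-disjoint disjoint)
      where
      B₁⊆M₁ : B₁ ⊆ E M₁
      B₁⊆M₁ = indep⊆E M₁ (proj₁ b₁)
      B₂⊆M₂ : B₂ ⊆ E M₂
      B₂⊆M₂ = indep⊆E M₂ (proj₁ b₂)
      disjoint : ∀ {x} → x ∈ B₁ → x ∉ B₂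
      disjoint x∈B₁ x∈B₂ = p∉B₁ (subst (_∈ B₁) (∩⇒≡p (B₁⊆M₁ x∈B₁) (B₂⊆M₂ x∈B₂)) x∈B₁)
      avoids : ∀ {C} → IsCocircuit S C → ¬ (∀ {x} → x ∈ C → x ∉ B₁ ∪ B₂)
      avoids {C} cC C∩U=∅ with Equivalence.to (cocircuits C) cC
      ... | inj₁ c₁ = proj₁ (proj₂ c₁)
        (B₁ , b₁ , λ x∈C → x∈p∧x∉q⇒x∈p─q (proj₁ c₁ x∈C) (C∩U=∅ x∈C ∘ p⊆p∪q B₂))
      ... | inj₂ (inj₁ c₂) = proj₁ (proj₂ c₂)
        (B₂ , b₂ , λ x∈C → x∈p∧x∉q⇒x∈p─q (proj₁ c₂ x∈C) (C∩U=∅ x∈C ∘ q⊆p∪q B₁ B₂))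
      -- The cocircuit `C₁` meets `B₁` in an element other than `p`, as `B₁` avoids `p`; this
      -- element survives the removal of `p`.
      ... | inj₂ (inj₂ (C₁ , C₂ , c₁ , _ , _ , _ , refl)) = proj₁ (proj₂ c₁)
        (B₁ , b₁ , λ x∈C₁ → x∈p∧x∉q⇒x∈p─q (proj₁ c₁ x∈C₁) (λ x∈B₁ →
          C∩U=∅ (x∈p∧x≢y⇒x∈p-y (p⊆p∪q C₂ x∈C₁) (λ x≡p → p∉B₁ (subst (_∈ B₁) x≡p x∈B₁)))
                (p⊆p∪q B₂ x∈B₁)))
      U-spans : rank S ≤ rk S (B₁ ∪ B₂)
      U-spans = ≮⇒≥ λ r< →
        let (C , cC , C⊆) = cocircuit⊆ S {E S ─ (B₁ ∪ B₂)} (p─q⊆p (E S) (B₁ ∪ B₂))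
              (≤-trans (s≤s (rk-mono S double-─)) r<)
        in avoids cC (λ x∈C → proj₂ (x∈p─q⁻ (E S) (B₁ ∪ B₂) (C⊆ x∈C)))
        where
        double-─ : E S ─ (E S ─ (B₁ ∪ B₂)) ⊆ B₁ ∪ B₂
        double-─ {x} x∈ with x∈p─q⁻ (E S) (E S ─ (B₁ ∪ B₂)) x∈ | x ∈? B₁ ∪ B₂
        ... | _ | yes x∈U = x∈U
        ... | x∈S , x∉ | no x∉U = contradiction (x∈p∧x∉q⇒x∈p─q x∈S x∉U) x∉
      rank≤ : rank S ≤ ∣ B₁ ∪ B₂ ∣
      rank≤ = ≤-trans U-spans (rk≤∣∣ S)
      rank≥ : ∣ B₁ ∪ B₂ ∣ ≤ rank S
      rank≥ =
        -- Independence of the union is reached indirectly: a largest independent subset `I` of it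
        -- spans `S`, and then contains both bases.
        let (I , I⊆U , i , ∣I∣) = rk-attained S (B₁ ∪ B₂)
            r≤I = ≤-trans U-spans (≤-reflexive (sym ∣I∣))
            B₁⊆I = basis-of-part⊆ {M = M₁} {S = S}
              (λ {C} c → Equivalence.from (cocircuits C) (inj₁ c)) b₁ i r≤I
              (λ x∈I x∈M₁ → [ id , (λ x∈B₂ → contradiction
                 (subst (_∈ B₂) (∩⇒≡p x∈M₁ (B₂⊆M₂ x∈B₂)) x∈B₂) p∉B₂) ]′ (x∈p∪q⁻ B₁ B₂ (I⊆U x∈I)))
            B₂⊆I = basis-of-part⊆ {M = M₂} {S = S}
              (λ {C} c → Equivalence.from (cocircuits C) (inj₂ (inj₁ c))) b₂ i r≤I
              (λ x∈I x∈M₂ → [ (λ x∈B₁ → contradiction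
                 (subst (_∈ B₁) (∩⇒≡p (B₁⊆M₁ x∈B₁) x∈M₂) x∈B₁) p∉B₁) , id ]′ (x∈p∪q⁻ B₁ B₂ (I⊆U x∈I)))
        in ≤-trans (p⊆q⇒∣p∣≤∣q∣ (∪-least B₁⊆I B₂⊆I)) (∣∣≤rank S i)

-- Both directions of the equality case and the theorem

rank-U₁ : ∀ c → rank (U 1 (suc c)) ≡ 1
rank-U₁ c = ≤-antisym
  (≤-trans (≤-reflexive (rank≡rk (U 1 (suc c)))) (rk-least (U 1 (suc c)) (λ _ ∣I∣≤1 → ∣I∣≤1)))
  (≤-trans (≤-reflexive (sym (∣⁅x⁆∣≡1 z))) (∣∣≤rank (U 1 (suc c)) {⁅ z ⁆} (≤-reflexive (∣⁅x⁆∣≡1 z))))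
  where
  z : Fin (suc c)
  z = zero

iterated⇒extremal : ∀ {c} {M : Matroid n} → IteratedSeries (suc c) M → ∣ E M ∣ ≡ c * rank M + 1
iterated⇒extremal {c = c} uniform = begin
  ∣ ⊤ {suc c} ∣                ≡⟨ ∣⊤∣≡n (suc c) ⟩
  suc c                        ≡⟨ +-comm 1 c ⟩
  c + 1                        ≡⟨ cong (_+ 1) (trans (cong (c *_) (rank-U₁ c)) (*-identityʳ c)) ⟨
  c * rank (U 1 (suc c)) + 1   ∎
  where open ≡-Reasoning
iterated⇒extremal {c = c} (iso {M = M} {N = N} M≅N is) = begin
  ∣ E N ∣        ≡⟨ ≤-antisym (≅⇒size≤ M≅N) (≅⇒size≤ (≅-sym M≅N)) ⟨
  ∣ E M ∣        ≡⟨ iterated⇒extremal is ⟩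
  c * rank M + 1 ≡⟨ cong (λ r → c * r + 1) (≤-antisym (≅⇒rank≤ M≅N) (≅⇒rank≤ (≅-sym M≅N))) ⟩
  c * rank N + 1 ∎
  where open ≡-Reasoning
iterated⇒extremal {c = c} (series {M₁ = M₁} {M₂ = M₂} {S = S} is₁ is₂ sc) = suc-injective (begin
  suc ∣ E S ∣                           ≡⟨ series-size sc ⟩
  ∣ E M₁ ∣ + ∣ E M₂ ∣                   ≡⟨ cong₂ _+_ (iterated⇒extremal is₁) (iterated⇒extremal is₂) ⟩
  (c * rank M₁ + 1) + (c * rank M₂ + 1) ≡⟨ cong (_+ (c * rank M₂ + 1)) (+-comm (c * rank M₁) 1) ⟩
  suc (c * rank M₁ + (c * rank M₂ + 1)) ≡⟨ cong suc (+-assoc (c * rank M₁) _ 1) ⟨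
  suc (c * rank M₁ + c * rank M₂ + 1)   ≡⟨ cong (λ x → suc (x + 1)) (*-distribˡ-+ c (rank M₁) (rank M₂)) ⟨
  suc (c * (rank M₁ + rank M₂) + 1)     ≡⟨ cong (λ r → suc (c * r + 1)) (series-rank sc) ⟨
  suc (c * rank S + 1)                  ∎)
  where open ≡-Reasoning

-- Induction on the rank, which is one more than `r`. In rank 1 looplessness makes every singleton
-- independent, so `M` is a copy of `U 1 (suc c)`; in higher rank the contraction of a parallel
-- class has rank one less.
extremal⇒iterated : ∀ {c} → 1 ≤ c → ∀ r (M : Matroid n) → MinimallyDegenerate (suc c) M →
  rank M ≡ suc r → ∣ E M ∣ ≡ c * rank M + 1 → IteratedSeries (suc c) M
extremal⇒iterated {c = c} 1≤c zero M deg rank≡ size≡ = iso (U₁≅ M size uniform₁) uniform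
  where
  open Degenerate 1≤c deg
  size : ∣ E M ∣ ≡ suc c
  size = trans size≡ (trans (cong (λ r → c * r + 1) rank≡)
    (trans (cong (_+ 1) (*-identityʳ c)) (+-comm c 1)))
  uniform₁ : ∀ {I} → I ⊆ E M → Indep M I ⇔ ∣ I ∣ ≤ 1
  uniform₁ {I} I⊆E = mk⇔ (λ i → ≤-trans (∣∣≤rank M i) (≤-reflexive rank≡)) small
    where
    small : ∣ I ∣ ≤ 1 → Indep M I
    small ∣I∣≤1 with nonempty? I
    ... | no empty = subst (Indep M) (sym (Empty-unique empty)) (indep-⊥ M)
    ... | yes (x , x∈I) = indep-⊆ M
      (⊆-by-size (x∈p⇒⁅x⁆⊆p x∈I) (≤-trans ∣I∣≤1 (≤-reflexive (sym (∣⁅x⁆∣≡1 x)))))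
      (indep-⁅⁆ (I⊆E x∈I))
extremal⇒iterated {c = c} 1≤c (suc r) M deg rank≡ size≡ =
  let open Degenerate 1≤c deg
      open Extremal rank≡ size≡
      (T , T⊆E , rkT , ∣T∣) = parallel-class
      (t , t∈T) = 0<∣p∣⇒Nonempty (≤-trans 1≤c (≤-reflexive (sym ∣T∣)))
      open Peel T⊆E rkT ∣T∣ t∈T (s≤s z≤n)
      (p , p∉T , cQ) = leaf-cocircuit
      open Leaf p∉T cQ
  in series
       (iso (U₁≅ (rank1 Q) (trans (∣p∪⁅x⁆∣≡1+∣p∣ p∉T) (cong suc ∣T∣))
                 (λ I⊆Q → mk⇔ proj₂ (λ ∣I∣≤1 → (λ {x} → I⊆Q {x}) , ∣I∣≤1)))
            uniform)
       (extremal⇒iterated 1≤c r N N-degenerate rank-N size-N)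
       series-connection

theorem1p3 : ∀ (k : ℕ) → 2 ≤ k →
    ∀ {n : ℕ} (M : Matroid n) → MinimallyDegenerate k M →
    (∣ E M ∣ ≤ (k ∸ 1) * rank M + 1) ×
    (∣ E M ∣ ≡ (k ∸ 1) * rank M + 1 ⇔ IteratedSeries k M)
theorem1p3 (suc c) (s≤s 1≤c) M deg =
  size-bound , mk⇔ (extremal⇒iterated 1≤c _ M deg (sym (suc-pred (rank M)))) iterated⇒extremal
  where
  open Degenerate 1≤c deg
  open MinimallyDegenerate deg
  instance
    -- Any element of a loopless matroid is an independent singleton; positive rank lets `suc-pred`
    -- put `rank M` in the form that the induction expects.
    rank-nonZero : NonZero (rank M)
    rank-nonZero = let (e , e∈E) = nonempty in >-nonZero
      (≤-trans (≤-reflexive (sym (∣⁅x⁆∣≡1 e))) (∣∣≤rank M (indep-⁅⁆ e∈E)))
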